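{- There is a constant $C>0$ such that for every graph $G$ of order $n\ge 4$ for which each of $G$ and its complement $\overline G$ has an edge, $$\frac{3n^2}{8}-Cn\ \le\ \operatorname{th}_{\operatorname{Z}}^{\ast}(G)\cdot\operatorname{th}_{\operatorname{Z}}^{\ast}(\overline G)$$ (that is, the product is at least $\frac{3n^2}{8}-O(n)$), and this bound is tight even when both $G$ and $\overline G$ are required to be connected: there are infinitely many graphs $G$, with $G$ and $\overline G$ both connected, for which $\operatorname{th}_{\operatorname{Z}}^{\ast}(G)\cdot\operatorname{th}_{\operatorname{Z}}^{\ast}(\overline G)=\frac{3n^2}{8}\pm o(n^2)$, where $n$ is the order of $G$.
   Context: Graphs are finite, simple, undirected, with nonempty vertex set; the order of $G$ is $|V(G)|$; $\overline G$ is the complement of $G$. Standard zero forcing: each vertex is filled or unfilled. Color change rule: if $w$ is the unique unfilled neighbor of a filled vertex $v$, then fill $w$. For $B\subseteq V(G)$ put $B^{[0]}=B$, and let $B^{[i+1]}$ be $B^{[i]}$ together with all vertices that can be filled by one application of the rule when exactly the vertices of $B^{[i]}$ are filled. $\operatorname{pt}_{\operatorname{Z}}(G;B)$ is the least $t$ with $B^{[t]}=V(G)$ ($\infty$ if none exists), and $\operatorname{pt}_{\operatorname{Z}}(G,k)=\min_{|B|=k}\operatorname{pt}_{\operatorname{Z}}(G;B)$. For a graph $G$ of order $n$ with at least one edge, the no initial cost product throttling number is $\operatorname{th}_{\operatorname{Z}}^{\ast}(G)=\min_{1\le k\le n-1}k\cdot\operatorname{pt}_{\operatorname{Z}}(G,k)$.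 -}

module Defs where

import Data.Bool.Properties as Bool
open import Data.Empty using (⊥-elim)
open import Data.Fin.Base using (Fin)
open import Data.Fin.Properties using (any?; all?) renaming (_≟_ to _≟F_)
open import Data.Fin.Subset
open import Data.Fin.Subset.Properties
  using (_∈?_; ⊆-antisym; ∈⊤; p⊆p∪q; x∈p∪q⁺; p⊂q⇒∣p∣<∣q∣; ∣p∣≤n; ∣p∣≡n⇒p≡⊤;
         ∣∁p∣≡n∸∣p∣; ∣⁅x⁆∣≡1; x∈p⇒x∉∁p; x∈⁅x⁆; x∉p⇒x∈∁p; x≢y⇒x∉⁅y⁆; x∉∁p⇒x∈p; x∈⁅y⁆⇒x≡y)
open import Data.Integer.Base using (+_)
open import Data.List.Base using (List; map; filter; applyUpTo; _++_) renaming ([_] to [_]ˡ)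
open import Data.List.Membership.Propositional using () renaming (_∈_ to _∈ˡ_; lose to loseˡ)
open import Data.List.Membership.Propositional.Properties
  using (∈-map⁺; ∈-++⁺ˡ; ∈-++⁺ʳ; ∈-filter⁺; ∈-applyUpTo⁺)
open import Data.List.Relation.Unary.Any using (here)
import Data.List.Extrema as Extrema
open import Data.Nat.Base as ℕ using (ℕ; zero; suc; _∸_; _<_; _≤_; z≤n; s≤s)
import Data.Nat.Properties as ℕ
open import Data.Product.Base using (∃; ∃₂; _×_; _,_; proj₁; proj₂)
open import Data.Rational.Base using (ℚ; _/_)
open import Data.Sum.Base using (_⊎_; inj₁; inj₂)
open import Data.Vec.Base using (tabulate; []; _∷_)
open import Data.Vec.Properties using (≡-dec; lookup∘tabulate; []=⇒lookup; lookup⇒[]=)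
open import Function.Base using (_∘_)
open import Level using (0ℓ)
open import Relation.Binary.Bundles using (TotalOrder)
open import Relation.Binary.Core using (Rel)
open import Relation.Binary.Definitions using (Decidable; Symmetric; Irreflexive)
import Relation.Binary.Construct.Add.Supremum.NonStrict as AddSup
open import Relation.Binary.Construct.Closure.ReflexiveTransitive using (Star)
open import Relation.Binary.PropositionalEquality
  using (_≡_; _≢_; refl; trans; cong; subst)
import Relation.Binary.PropositionalEquality as ≡
open import Relation.Nullary
open import Relation.Nullary.Decidable using (does; dec-true; _×-dec_; _→-dec_; ¬?)
open import Relation.Nullary.Construct.Add.Supremum using (_⁺; ⊤⁺)
  renaming ([_] to fin)
import Relation.Unary as U

-- A finite simple graph of order n, on the vertex set Fin n. Adjacency is
-- decidable, as for any finite graph given explicitly. Order 0 is not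
-- excluded here; the hypotheses 4 ≤ n and HasEdge exclude it where needed.
record Graph (n : ℕ) : Set₁ where
  field
    Adj    : Rel (Fin n) 0ℓ
    adj?   : Decidable Adj
    sym    : Symmetric Adj
    irrefl : Irreflexive _≡_ Adj

open Graph

complement : ∀ {n} → Graph n → Graph n
complement G .Adj u v          = u ≢ v × ¬ Adj G u v
complement G .adj? u v         = ¬? (u ≟F v) ×-dec ¬? (adj? G u v)
complement G .sym (u≢v , ¬uv)  = u≢v ∘ ≡.sym , ¬uv ∘ sym G
complement G .irrefl u≡v (u≢v , _) = u≢v u≡v

HasEdge : ∀ {n} → Graph n → Set
HasEdge G = ∃₂ λ u v → Adj G u v

Connected : ∀ {n} → Graph n → Set
Connected G = ∀ u v → Star (Adj G) u v

-- v can fill w when exactly the vertices of B are filled.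
Forces : ∀ {n} → Graph n → Subset n → Fin n → Fin n → Set
Forces G B v w =
  v ∈ B × Adj G v w × w ∉ B × (∀ u → Adj G v u → u ∉ B → u ≡ w)

Forced : ∀ {n} → Graph n → Subset n → Fin n → Set
Forced G B w = ∃ λ v → Forces G B v w

forced? : ∀ {n} (G : Graph n) B → U.Decidable (Forced G B)
forced? G B w = any? λ v →
  (v ∈? B) ×-dec adj? G v w ×-dec ¬? (w ∈? B) ×-dec
  all? λ u → adj? G v u →-dec ¬? (u ∈? B) →-dec (u ≟F w)

comprehension : ∀ {n} {P : Fin n → Set} → U.Decidable P → Subset n
comprehension P? = tabulate (does ∘ P?)

step : ∀ {n} → Graph n → Subset n → Subset n
step G B = B ∪ comprehension (forced? G B)

-- filled G B i is B^[i].
filled : ∀ {n} → Graph n → Subset n → ℕ → Subset n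
filled G B zero    = B
filled G B (suc i) = step G (filled G B i)

-- ⊤⁺ plays the role of ∞.
ℕ∞ : Set
ℕ∞ = ℕ ⁺

ℕ∞-totalOrder : TotalOrder 0ℓ 0ℓ 0ℓ
ℕ∞-totalOrder = record
  { isTotalOrder = AddSup.≤⁺-isTotalOrder-≡ ℕ._≤_ ℕ.≤-isTotalOrder }

-- Minimum of a finite list, with min ∅ = ∞.
minimum : List ℕ∞ → ℕ∞
minimum = Extrema.min ℕ∞-totalOrder ⊤⁺

-- Only used with a positive left factor, so 0 · ∞ does not matter.
infixl 7 _·_
_·_ : ℕ → ℕ∞ → ℕ∞
k · fin t = fin (k ℕ.* t)
k · ⊤⁺    = ⊤⁺

toℕ∞ : (x : ℕ∞) → x ≢ ⊤⁺ → ℕ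
toℕ∞ (fin t) _   = t
toℕ∞ ⊤⁺      x≢∞ = ⊥-elim (x≢∞ refl)

IsPt : ∀ {n} → Graph n → Subset n → ℕ∞ → Set
IsPt G B (fin t) = filled G B t ≡ ⊤ × (∀ s → filled G B s ≡ ⊤ → t ≤ s)
IsPt G B ⊤⁺      = ∀ s → filled G B s ≢ ⊤

module _ {n} {P : Fin n → Set} (P? : U.Decidable P) where

  ∈-comprehension⁺ : ∀ {x} → P x → x ∈ comprehension P?
  ∈-comprehension⁺ {x} px = lookup⇒[]= x _
    (trans (lookup∘tabulate (does ∘ P?) x) (dec-true (P? x) px))

  ∈-comprehension⁻ : ∀ {x} → x ∈ comprehension P? → P x
  ∈-comprehension⁻ {x} x∈ with P? x
    | trans (≡.sym (lookup∘tabulate (does ∘ P?) x)) ([]=⇒lookup x∈)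
  ... | yes px | _ = px
  ... | no _   | ()

module _ {n} (G : Graph n) where

  filled-step : ∀ B t → filled G (step G B) t ≡ filled G B (suc t)
  filled-step B zero    = refl
  filled-step B (suc t) = cong (step G) (filled-step B t)

  filled-fixed : ∀ {B} → step G B ≡ B → ∀ t → filled G B t ≡ B
  filled-fixed fix zero    = refl
  filled-fixed fix (suc t) = trans (cong (step G) (filled-fixed fix t)) fix

  pt-exists : ∀ B fuel → n ∸ ∣ B ∣ ≤ fuel → ∃ (IsPt G B)
  pt-exists B fuel le with ≡-dec Bool._≟_ B ⊤
  ... | yes B≡⊤ = fin 0 , B≡⊤ , λ _ _ → z≤n
  pt-exists B fuel le | no B≢⊤ with any? (λ w → (w ∈? step G B) ×-dec ¬? (w ∈? B))
  ... | no ¬new = ⊤⁺ , λ s eq → B≢⊤ (trans (≡.sym (filled-fixed fix s)) eq)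
    where
    back : step G B ⊆ B
    back {x} x∈ with x ∈? B
    ... | yes x∈B = x∈B
    ... | no x∉B  = ⊥-elim (¬new (x , x∈ , x∉B))
    fix : step G B ≡ B
    fix = ⊆-antisym back (p⊆p∪q _)
  pt-exists B zero le | no B≢⊤ | yes _ =
    ⊥-elim (B≢⊤ (∣p∣≡n⇒p≡⊤ (ℕ.≤-antisym (∣p∣≤n B) (ℕ.m∸n≡0⇒m≤n (ℕ.n≤0⇒n≡0 le)))))
  pt-exists B (suc fuel) le | no B≢⊤ | yes new =
    shift (pt-exists (step G B) fuel (ℕ.s≤s⁻¹ (ℕ.≤-trans smaller le)))
    where
    smaller : n ∸ ∣ step G B ∣ < n ∸ ∣ B ∣
    smaller = ℕ.∸-monoʳ-< (p⊂q⇒∣p∣<∣q∣ (p⊆p∪q _ , new)) (∣p∣≤n (step G B))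
    shift : ∃ (IsPt G (step G B)) → ∃ (IsPt G B)
    shift (fin t , eq , least) = fin (suc t) , trans (≡.sym (filled-step B t)) eq , λ where
      zero    eq′ → ⊥-elim (B≢⊤ eq′)
      (suc s) eq′ → s≤s (least s (trans (filled-step B s) eq′))
    shift (⊤⁺ , never) = ⊤⁺ , λ where
      zero    eq′ → B≢⊤ eq′
      (suc s) eq′ → never s (trans (filled-step B s) eq′)

-- pt(G; B), the least t with B^[t] = V(G), or ∞.
pt : ∀ {n} → Graph n → Subset n → ℕ∞
pt {n} G B = proj₁ (pt-exists G B (n ∸ ∣ B ∣) ℕ.≤-refl)

pt-spec : ∀ {n} (G : Graph n) B → IsPt G B (pt G B)
pt-spec {n} G B = proj₂ (pt-exists G B (n ∸ ∣ B ∣) ℕ.≤-refl)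

allSubsets : ∀ n → List (Subset n)
allSubsets zero    = [ [] ]ˡ
allSubsets (suc n) = map (inside ∷_) (allSubsets n) ++ map (outside ∷_) (allSubsets n)

∈-allSubsets : ∀ {n} (B : Subset n) → B ∈ˡ allSubsets n
∈-allSubsets []            = here refl
∈-allSubsets (inside  ∷ B) = ∈-++⁺ˡ (∈-map⁺ _ (∈-allSubsets B))
∈-allSubsets (outside ∷ B) =
  ∈-++⁺ʳ (map (inside ∷_) (allSubsets _)) (∈-map⁺ _ (∈-allSubsets B))

-- pt(G, k), the minimum of pt(G; B) over |B| = k.
ptₖ : ∀ {n} → Graph n → ℕ → ℕ∞
ptₖ {n} G k = minimum (map (pt G) (filter (λ B → ∣ B ∣ ℕ.≟ k) (allSubsets n)))

-- The minimum of k · pt(G, k) over k = 1, …, n − 1.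
th∞ : ∀ {n} → Graph n → ℕ∞
th∞ {n} G = minimum (map (λ k → k · ptₖ G k) (applyUpTo suc (n ∸ 1)))

private
  minimum≢∞ : ∀ {x xs} → x ∈ˡ xs → x ≢ ⊤⁺ → minimum xs ≢ ⊤⁺
  minimum≢∞ {x} {xs} x∈xs x≢∞ eq = lemma x x≢∞
    (subst (λ m → AddSup._≤⁺_ ℕ._≤_ m x) eq
      (Extrema.min≤v⁺ ℕ∞-totalOrder ⊤⁺ xs
        (inj₂ (loseˡ x∈xs (TotalOrder.refl ℕ∞-totalOrder)))))
    where
    lemma : ∀ x → x ≢ ⊤⁺ → ¬ AddSup._≤⁺_ ℕ._≤_ ⊤⁺ x
    lemma (fin _) _   ()
    lemma ⊤⁺      x≢∞ _ = x≢∞ refl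

  ·≢∞ : ∀ k {x} → x ≢ ⊤⁺ → k · x ≢ ⊤⁺
  ·≢∞ k {fin _} _   ()
  ·≢∞ k {⊤⁺}    x≢∞ _ = x≢∞ refl

-- If uv is an edge, the n − 1 vertices other than v fill v in one step.
th-finite : ∀ {n} (G : Graph n) → HasEdge G → th∞ G ≢ ⊤⁺
th-finite {zero}        G (() , _)
th-finite {suc zero}    G (Fin.zero , Fin.zero , uv) = ⊥-elim (irrefl G refl uv)
th-finite {suc (suc m)} G (u , v , uv) =
  minimum≢∞ (∈-map⁺ _ (∈-applyUpTo⁺ suc (ℕ.n<1+n m)))
    (·≢∞ (suc m) (minimum≢∞ (∈-map⁺ (pt G)
      (∈-filter⁺ (λ B → ∣ B ∣ ℕ.≟ suc m) (∈-allSubsets B) ∣B∣≡)) pt≢∞))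
  where
  B = ∁ ⁅ v ⁆
  ∣B∣≡ : ∣ B ∣ ≡ suc m
  ∣B∣≡ = trans (∣∁p∣≡n∸∣p∣ ⁅ v ⁆) (cong (suc (suc m) ∸_) (∣⁅x⁆∣≡1 v))
  forces : Forces G B u v
  forces = x∉p⇒x∈∁p (x≢y⇒x∉⁅y⁆ λ u≡v → irrefl G u≡v uv) , uv
         , x∈p⇒x∉∁p (x∈⁅x⁆ v) , λ w _ w∉B → x∈⁅y⁆⇒x≡y v (x∉∁p⇒x∈p w∉B)
  full : step G B ≡ ⊤
  full = ⊆-antisym (λ _ → ∈⊤) λ {x} _ → x∈p∪q⁺ (in-step x)
    where
    in-step : ∀ x → x ∈ B ⊎ x ∈ comprehension (forced? G B)
    in-step x with x ∈? B
    ... | yes x∈B = inj₁ x∈B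
    ... | no  x∉B with x∈⁅y⁆⇒x≡y v (x∉∁p⇒x∈p x∉B)
    ... | refl = inj₂ (∈-comprehension⁺ (forced? G B) (u , forces))
  pt≢∞ : pt G B ≢ ⊤⁺
  pt≢∞ eq = subst (IsPt G B) eq (pt-spec G B) 1 full

th* : ∀ {n} (G : Graph n) → HasEdge G → ℕ
th* G e = toℕ∞ (th∞ G) (th-finite G e)

fromℕ : ℕ → ℚ
fromℕ k = + k / 1

{-# OPTIONS --safe #-}
module Submission where

open import Defs
open import Data.Empty using (⊥-elim) renaming (⊥ to ⊥ᵗ)
open import Data.Fin.Base using (Fin; zero; suc; combine; remQuot; quotient)
open import Data.Fin.Properties using (any?; remQuot-combine; combine-remQuot; combine-injective)
  renaming (_≟_ to _≟ᶠ_; suc-injective to sucᶠ-injective)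
open import Data.Fin.Subset
  using (Subset; inside; outside; _∈_; _∉_; ⊤; ∁; _∩_; _∪_; Empty)
  renaming (_-_ to _∖_; ∣_∣ to ∣_∣ˢ)
open import Data.Fin.Subset.Properties
open import Data.Integer.Base as ℤ using (+_; +[1+_])
import Data.Integer.Properties as ℤ
open import Data.List.Base using (List; map; filter; applyUpTo)
import Data.List.Extrema ℕ∞-totalOrder as Extrema
open import Data.List.Membership.Propositional using (lose) renaming (_∈_ to _∈ˡ_)
open import Data.List.Membership.Propositional.Properties
  using (∈-map⁺; ∈-map⁻; ∈-filter⁺; ∈-filter⁻; ∈-applyUpTo⁺; ∈-applyUpTo⁻)
open import Data.Nat.Base as ℕ using (ℕ; zero; suc; z≤n; s≤s; _∸_)
import Data.Nat.Properties as ℕ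
open import Data.Nat.Tactic.RingSolver using (solve-∀)
open import Data.Product.Base using (Σ-syntax; ∃; ∃₂; _×_; _,_; proj₁; proj₂)
open import Data.Rational.Base
  using (ℚ; 0ℚ; _/_; _+_; _*_; _-_; -_; _≤_; _<_; ∣_∣; mkℚ; toℚᵘ; *<*; nonNegative)
import Data.Rational.Properties as ℚ
open import Data.Rational.Solver using (module +-*-Solver)
open import Data.Rational.Unnormalised.Base as ℚᵘ using (mkℚᵘ; *≡*; *≤*)
import Data.Rational.Unnormalised.Properties as ℚᵘ
open import Data.Sum.Base using (_⊎_; inj₁; inj₂)
open import Data.Vec.Base using ([]; _∷_; here; there)
open import Function.Base using (_∘_; id; case_of_)
open import Level using (0ℓ)
open import Relation.Binary.Construct.Add.Supremum.NonStrict ℕ._≤_ using ([_])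
open import Relation.Binary.Construct.Closure.ReflexiveTransitive using (Star; _◅_; _◅◅_)
  renaming (ε to stay)
open import Relation.Binary.Core using (Rel)
open import Relation.Binary.PropositionalEquality
open import Relation.Nullary
open import Relation.Nullary.Construct.Add.Supremum using ([]-injective; ⊤⁺)
  renaming ([_] to fin)
open import Relation.Nullary.Decidable using (_×-dec_; ¬?; decidable-stable)

-- Let F be the largest set of vertices filled in a single round of a zero
-- forcing process from B with |B| = k and t rounds. A filled vertex with an
-- unfilled neighbour can be charged to B, so |F| ≤ k, and
-- n ≤ k + t|F| ≤ kt + |F|. Hence th*(G) ≥ n − |F|, where F and the vertices
-- forcing it span a perfect matching in G as a bipartite graph; conversely such
-- a matching of size m gives th*(G) ≤ n − m in one round.
--
-- Let U, V be matched in this way in G and A, B in the complement, with sizes m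
-- and m′. A vertex of U ∩ A leaves room for at most two vertices in V ∩ B, and
-- similarly for U ∩ B and V ∩ A. So one of the four sets essentially avoids
-- both sides of the other matching: 2m + m′ ≤ n + 4 or m + 2m′ ≤ n + 4.
-- Together with m, m′ ≤ n/2 this gives (n − m)(n − m′) ≥ 3n²/8 − 4n, with near
-- equality at m = n/4, m′ = n/2, which the extremal graphs attain.

open Graph using (Adj; adj?) renaming (sym to adj-sym; irrefl to adj-irrefl)

private variable
  m n : ℕ

-- Cardinalities of finite subsets

-- Injectivity is asked for on `p` alone because the maps counted below, such as `forcer`, take
-- default values elsewhere.
injection⇒∣p∣≤∣q∣ : (f : Fin m → Fin n) (p : Subset m) (q : Subset n) →
  (∀ {x} → x ∈ p → f x ∈ q) →
  (∀ {x y} → x ∈ p → y ∈ p → f x ≡ f y → x ≡ y) →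
  ∣ p ∣ˢ ℕ.≤ ∣ q ∣ˢ
injection⇒∣p∣≤∣q∣ f []            q into inj = z≤n
injection⇒∣p∣≤∣q∣ f (outside ∷ p) q into inj =
  injection⇒∣p∣≤∣q∣ (f ∘ suc) p q (into ∘ there)
    λ x∈ y∈ eq → sucᶠ-injective (inj (there x∈) (there y∈) eq)
injection⇒∣p∣≤∣q∣ f (inside ∷ p)  q into inj =
  -- The image of `zero` is deleted from `q`; by injectivity the remaining images survive the
  -- deletion.
  ℕ.≤-trans (s≤s (injection⇒∣p∣≤∣q∣ (f ∘ suc) p (q ∖ f zero)
      (λ x∈ → x∈p∧x≢y⇒x∈p-y (into (there x∈))
        λ eq → case inj (there x∈) here eq of λ ())
      λ x∈ y∈ eq → sucᶠ-injective (inj (there x∈) (there y∈) eq)))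
    (x∈p⇒∣p-x∣<∣p∣ (into here))

∣p∪q∣+∣p∩q∣≡∣p∣+∣q∣ : (p q : Subset n) → ∣ p ∪ q ∣ˢ ℕ.+ ∣ p ∩ q ∣ˢ ≡ ∣ p ∣ˢ ℕ.+ ∣ q ∣ˢ
∣p∪q∣+∣p∩q∣≡∣p∣+∣q∣ []            []            = refl
∣p∪q∣+∣p∩q∣≡∣p∣+∣q∣ (inside  ∷ p) (inside  ∷ q) = cong suc
  (trans (ℕ.+-suc _ _) (trans (cong suc (∣p∪q∣+∣p∩q∣≡∣p∣+∣q∣ p q)) (sym (ℕ.+-suc _ _))))
∣p∪q∣+∣p∩q∣≡∣p∣+∣q∣ (inside  ∷ p) (outside ∷ q) = cong suc (∣p∪q∣+∣p∩q∣≡∣p∣+∣q∣ p q)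
∣p∪q∣+∣p∩q∣≡∣p∣+∣q∣ (outside ∷ p) (inside  ∷ q) =
  trans (cong suc (∣p∪q∣+∣p∩q∣≡∣p∣+∣q∣ p q)) (sym (ℕ.+-suc _ _))
∣p∪q∣+∣p∩q∣≡∣p∣+∣q∣ (outside ∷ p) (outside ∷ q) = ∣p∪q∣+∣p∩q∣≡∣p∣+∣q∣ p q

∣p∪q∣≤∣p∣+∣q∣ : (p q : Subset n) → ∣ p ∪ q ∣ˢ ℕ.≤ ∣ p ∣ˢ ℕ.+ ∣ q ∣ˢ
∣p∪q∣≤∣p∣+∣q∣ p q = subst (∣ p ∪ q ∣ˢ ℕ.≤_) (∣p∪q∣+∣p∩q∣≡∣p∣+∣q∣ p q) (ℕ.m≤m+n _ _)

∣p∣+∣q∣≤n+∣p∩q∣ : (p q : Subset n) → ∣ p ∣ˢ ℕ.+ ∣ q ∣ˢ ℕ.≤ n ℕ.+ ∣ p ∩ q ∣ˢ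
∣p∣+∣q∣≤n+∣p∩q∣ {n} p q = subst (ℕ._≤ n ℕ.+ ∣ p ∩ q ∣ˢ) (∣p∪q∣+∣p∩q∣≡∣p∣+∣q∣ p q)
  (ℕ.+-monoˡ-≤ _ (∣p∣≤n (p ∪ q)))

Empty⇒∣p∣≤k : ∀ {p : Subset n} k → Empty p → ∣ p ∣ˢ ℕ.≤ k
Empty⇒∣p∣≤k {n} k ¬p rewrite Empty-unique ¬p | ∣⊥∣≡0 n = z≤n

-- The throttling number and its witnesses

fin-toℕ∞ : ∀ x x≢∞ → fin (toℕ∞ x x≢∞) ≡ x
fin-toℕ∞ (fin t) _   = refl
fin-toℕ∞ ⊤⁺      x≢∞ = ⊥-elim (x≢∞ refl)

·≡fin : ∀ k x {c} → k · x ≡ fin c → ∃ λ t → x ≡ fin t × c ≡ k ℕ.* t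
·≡fin k (fin t) refl = t , refl , refl

minimum-attained : ∀ {t} xs → minimum xs ≡ fin t → fin t ∈ˡ xs
minimum-attained xs eq with Extrema.argmin-sel id ⊤⁺ xs
-- The search may also return its default `⊤⁺`, which a finite minimum rules out.
... | inj₁ ≡∞ = case trans (sym eq) ≡∞ of λ ()
... | inj₂ ∈xs = subst (_∈ˡ xs) eq ∈xs

minimum-≤ : ∀ {t} xs → fin t ∈ˡ xs → ∃ λ s → minimum xs ≡ fin s × s ℕ.≤ t
minimum-≤ xs t∈ with minimum xs | Extrema.min≤v⁺ ⊤⁺ xs (inj₂ (lose t∈ [ ℕ.≤-refl ]))
... | fin s | [ s≤t ] = s , refl , s≤t

∈-applyUpTo-suc : ∀ {k n} → 0 ℕ.< k → k ℕ.< n → k ∈ˡ applyUpTo suc (n ∸ 1)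
∈-applyUpTo-suc {suc k} _ (s≤s k<n) = ∈-applyUpTo⁺ suc k<n

i<n∸1⇒1+i<n : ∀ {i} n → i ℕ.< n ∸ 1 → suc i ℕ.< n
i<n∸1⇒1+i<n (suc n) i<n = s≤s i<n

module _ (G : Graph n) where

  private
    ofSize : ℕ → List (Subset n)
    ofSize k = filter (λ B → ∣ B ∣ˢ ℕ.≟ k) (allSubsets n)

    costs : List ℕ∞
    costs = map (λ k → k · ptₖ G k) (applyUpTo suc (n ∸ 1))

  -- A finite minimum is attained, so the two nested minima, over the size and over the sets of that
  -- size, can be opened up to an actual set and time. The range of sizes gives the strict bounds on
  -- `∣ B ∣ˢ`.
  th*-attained : (e : HasEdge G) → ∃₂ λ B t →
    th* G e ≡ ∣ B ∣ˢ ℕ.* t × 0 ℕ.< ∣ B ∣ˢ × ∣ B ∣ˢ ℕ.< n × filled G B t ≡ ⊤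
  th*-attained e
    with _ , k∈ , eq ← ∈-map⁻ (λ k → k · ptₖ G k)
           (minimum-attained costs (sym (fin-toℕ∞ (th∞ G) (th-finite G e))))
    with i , i<n∸1 , refl ← ∈-applyUpTo⁻ suc {n = n ∸ 1} k∈
    with t , ptₖ≡ , th≡ ← ·≡fin (suc i) (ptₖ G (suc i)) (sym eq)
    with B , B∈ , pt≡ ← ∈-map⁻ (pt G) (minimum-attained (map (pt G) (ofSize (suc i))) ptₖ≡)
    with _ , ∣B∣≡ ← ∈-filter⁻ (λ B → ∣ B ∣ˢ ℕ.≟ suc i) {xs = allSubsets n} B∈
    = B , t
    , trans th≡ (cong (ℕ._* t) (sym ∣B∣≡))
    , subst (0 ℕ.<_) (sym ∣B∣≡) (s≤s z≤n)
    , subst (ℕ._< n) (sym ∣B∣≡) (i<n∸1⇒1+i<n n i<n∸1)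
    , proj₁ (subst (IsPt G B) (sym pt≡) (pt-spec G B))

  pt-≤ : ∀ B t → filled G B t ≡ ⊤ → ∃ λ s → pt G B ≡ fin s × s ℕ.≤ t
  pt-≤ B t full = bound (pt G B) (pt-spec G B)
    where
    bound : ∀ x → IsPt G B x → ∃ λ s → x ≡ fin s × s ℕ.≤ t
    bound (fin s) (_ , least) = s , refl , least t full
    bound ⊤⁺      never       = ⊥-elim (never t full)

  -- The set `B` competes in both minima, and its propagation time is at most `t`.
  th*-≤ : (e : HasEdge G) → ∀ B t → 0 ℕ.< ∣ B ∣ˢ → ∣ B ∣ˢ ℕ.< n → filled G B t ≡ ⊤ →
    th* G e ℕ.≤ ∣ B ∣ˢ ℕ.* t
  th*-≤ e B t 0<B B<n full
    with s , pt≡ , s≤t ← pt-≤ B t full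
    with r , ptₖ≡ , r≤s ← minimum-≤ (map (pt G) (ofSize ∣ B ∣ˢ))
           (subst (_∈ˡ map (pt G) (ofSize ∣ B ∣ˢ)) pt≡ (∈-map⁺ (pt G)
             (∈-filter⁺ (λ A → ∣ A ∣ˢ ℕ.≟ ∣ B ∣ˢ) (∈-allSubsets B) refl)))
    with q , th≡ , q≤ ← minimum-≤ costs
           (subst (_∈ˡ costs) (cong (∣ B ∣ˢ ·_) ptₖ≡)
             (∈-map⁺ (λ k → k · ptₖ G k) (∈-applyUpTo-suc 0<B B<n)))
    = begin
      th* G e           ≡⟨ []-injective (trans (fin-toℕ∞ (th∞ G) (th-finite G e)) th≡) ⟩
      q                 ≤⟨ q≤ ⟩
      ∣ B ∣ˢ ℕ.* r       ≤⟨ ℕ.*-monoʳ-≤ ∣ B ∣ˢ (ℕ.≤-trans r≤s s≤t) ⟩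
      ∣ B ∣ˢ ℕ.* t       ∎
    where
    open ℕ.≤-Reasoning

-- Cross matchings

-- The bipartite graph of `R` between `U` and `V` has maximum degree one, and both sides have at
-- least `m` vertices: this is what the counting draws from the perfect matching between forcers and
-- forced vertices.
record CrossMatching (R : Rel (Fin n) 0ℓ) (m : ℕ) : Set where
  field
    U V      : Subset n
    disjoint : ∀ {x} → x ∈ U → x ∈ V → ⊥ᵗ
    m≤∣U∣    : m ℕ.≤ ∣ U ∣ˢ
    m≤∣V∣    : m ℕ.≤ ∣ V ∣ˢ
    uniqueᵛ  : ∀ {u v w} → u ∈ U → v ∈ V → w ∈ V → R u v → R u w → v ≡ w
    uniqueᵘ  : ∀ {u v w} → u ∈ V → v ∈ U → w ∈ U → R u v → R u w → v ≡ w

  -- Lets one argument about the pairs `U`, `U` and `V`, `V` of two matchings serve the mixed pairs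
  -- as well.
  swap : CrossMatching R m
  swap = record
    { U = V ; V = U
    ; disjoint = λ x∈V x∈U → disjoint x∈U x∈V
    ; m≤∣U∣ = m≤∣V∣ ; m≤∣V∣ = m≤∣U∣
    ; uniqueᵛ = uniqueᵘ ; uniqueᵘ = uniqueᵛ }

  m+m≤n : m ℕ.+ m ℕ.≤ n
  m+m≤n = begin
    m ℕ.+ m             ≤⟨ ℕ.+-mono-≤ m≤∣U∣ m≤∣V∣ ⟩
    ∣ U ∣ˢ ℕ.+ ∣ V ∣ˢ     ≤⟨ ∣p∣+∣q∣≤n+∣p∩q∣ U V ⟩
    n ℕ.+ ∣ U ∩ V ∣ˢ     ≤⟨ ℕ.+-monoʳ-≤ n (Empty⇒∣p∣≤k 0 λ (x , x∈) →
                             let x∈U , x∈V = x∈p∩q⁻ U V x∈ in disjoint x∈U x∈V) ⟩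
    n ℕ.+ 0             ≡⟨ ℕ.+-identityʳ n ⟩
    n                   ∎
    where open ℕ.≤-Reasoning

-- Rounds of zero forcing and the frontier

module Round (G : Graph n) (B : Subset n) where

  new : Subset n
  new = comprehension (forced? G B)

  ∈new⇒Forced : ∀ {w} → w ∈ new → Forced G B w
  ∈new⇒Forced = ∈-comprehension⁻ (forced? G B)

  forcer : Fin n → Fin n
  forcer w with forced? G B w
  ... | yes (v , _) = v
  -- A default value; every fact about `forcer` is stated on `new`.
  ... | no _        = w

  forcer-Forces : ∀ {w} → w ∈ new → Forces G B (forcer w) w
  forcer-Forces {w} w∈ with forced? G B w
  ... | yes (v , v→w) = v→w
  ... | no ¬w         = ⊥-elim (¬w (∈new⇒Forced w∈))

  forcer∈B : ∀ {w} → w ∈ new → forcer w ∈ B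
  forcer∈B w∈ = proj₁ (forcer-Forces w∈)

  forcer~ : ∀ {w} → w ∈ new → Adj G (forcer w) w
  forcer~ w∈ = proj₁ (proj₂ (forcer-Forces w∈))

  new∉B : ∀ {w} → w ∈ new → w ∉ B
  new∉B w∈ = proj₁ (proj₂ (proj₂ (forcer-Forces w∈)))

  forcer-unique : ∀ {w u} → w ∈ new → Adj G (forcer w) u → u ∉ B → u ≡ w
  forcer-unique w∈ = proj₂ (proj₂ (proj₂ (forcer-Forces w∈))) _

  -- Both vertices are unfilled neighbours of the common forcer, which has only one.
  forcer-injective : ∀ {v w} → v ∈ new → w ∈ new → forcer v ≡ forcer w → v ≡ w
  forcer-injective {v} v∈ w∈ eq =
    forcer-unique w∈ (subst (λ x → Adj G x v) eq (forcer~ v∈)) (new∉B v∈)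

  forcer-image? : ∀ x → Dec (∃ λ w → w ∈ new × forcer w ≡ x)
  forcer-image? x = any? λ w → (w ∈? new) ×-dec (forcer w ≟ᶠ x)

  forcers : Subset n
  forcers = comprehension forcer-image?

  ∈forcers⁻ : ∀ {x} → x ∈ forcers → ∃ λ w → w ∈ new × forcer w ≡ x
  ∈forcers⁻ = ∈-comprehension⁻ forcer-image?

  -- Forcers lie in `B` and forced vertices outside it. As each forcer has a single neighbour
  -- outside `B`, no vertex has two neighbours on the other side.
  matching : CrossMatching (Adj G) ∣ new ∣ˢ
  matching = record
    { U = forcers ; V = new
    ; disjoint = disjoint
    ; m≤∣U∣ = injection⇒∣p∣≤∣q∣ forcer new forcers
        (λ w∈ → ∈-comprehension⁺ forcer-image? (_ , w∈ , refl)) forcer-injective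
    ; m≤∣V∣ = ℕ.≤-refl
    ; uniqueᵛ = uniqueᵛ ; uniqueᵘ = uniqueᵘ }
    where
    disjoint : ∀ {x} → x ∈ forcers → x ∈ new → ⊥ᵗ
    disjoint x∈ x∈new with w , w∈ , refl ← ∈forcers⁻ x∈ = new∉B x∈new (forcer∈B w∈)
    uniqueᵛ : ∀ {u v w} → u ∈ forcers → v ∈ new → w ∈ new →
      Adj G u v → Adj G u w → v ≡ w
    uniqueᵛ u∈ v∈ w∈ uv uw with _ , x∈ , refl ← ∈forcers⁻ u∈ =
      trans (forcer-unique x∈ uv (new∉B v∈)) (sym (forcer-unique x∈ uw (new∉B w∈)))
    uniqueᵘ : ∀ {u v w} → u ∈ new → v ∈ forcers → w ∈ forcers →
      Adj G u v → Adj G u w → v ≡ w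
    uniqueᵘ u∈ v∈ w∈ uv uw
      with _ , x∈ , refl ← ∈forcers⁻ v∈ | _ , y∈ , refl ← ∈forcers⁻ w∈ =
      -- The vertex `u` is the only unfilled neighbour of both forcers, so both were chosen to force
      -- `u`.
      cong forcer (trans (sym (forcer-unique x∈ (adj-sym G uv) (new∉B u∈)))
                         (forcer-unique y∈ (adj-sym G uw) (new∉B u∈)))

-- Forcers lie on the frontier and leave it once they have forced, so the
-- frontier never grows; this replaces the count of forcing chains.
module _ (G : Graph n) where

  OnFrontier : Subset n → Fin n → Set
  OnFrontier B x = x ∈ B × ∃ λ y → Adj G x y × y ∉ B

  onFrontier? : ∀ B x → Dec (OnFrontier B x)
  onFrontier? B x = (x ∈? B) ×-dec any? λ y → adj? G x y ×-dec ¬? (y ∈? B)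

  frontier : Subset n → Subset n
  frontier B = comprehension (onFrontier? B)

  ∣new∣≤∣frontier∣ : ∀ B → ∣ Round.new G B ∣ˢ ℕ.≤ ∣ frontier B ∣ˢ
  ∣new∣≤∣frontier∣ B = injection⇒∣p∣≤∣q∣ forcer new (frontier B)
    (λ w∈ → ∈-comprehension⁺ (onFrontier? B) (forcer∈B w∈ , _ , forcer~ w∈ , new∉B w∈))
    forcer-injective
    where open Round G B

  ∣frontier-step∣≤∣frontier∣ : ∀ B → ∣ frontier (step G B) ∣ˢ ℕ.≤ ∣ frontier B ∣ˢ
  ∣frontier-step∣≤∣frontier∣ B = injection⇒∣p∣≤∣q∣ back (frontier (step G B)) (frontier B) into inj
    where
    open Round G B

    -- A vertex already in `B` is charged to itself, and a newly filled one to its forcer.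
    back : Fin n → Fin n
    back x with x ∈? B
    ... | yes _ = x
    ... | no _  = forcer x

    on : ∀ {x} → x ∈ frontier (step G B) → OnFrontier (step G B) x
    on = ∈-comprehension⁻ (onFrontier? (step G B))

    x∉B⇒x∈new : ∀ {x} → x ∈ frontier (step G B) → x ∉ B → x ∈ new
    x∉B⇒x∈new x∈ x∉B with x∈p∪q⁻ B new (proj₁ (on x∈))
    ... | inj₁ x∈B   = ⊥-elim (x∉B x∈B)
    ... | inj₂ x∈new = x∈new

    into : ∀ {x} → x ∈ frontier (step G B) → back x ∈ frontier B
    into {x} x∈ with x ∈? B
    ... | yes x∈B with _ , y , xy , y∉ ← on x∈ =
      ∈-comprehension⁺ (onFrontier? B) (x∈B , y , xy , y∉ ∘ p⊆p∪q new)
    ... | no x∉B with w∈ ← x∉B⇒x∈new x∈ x∉B =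
      ∈-comprehension⁺ (onFrontier? B) (forcer∈B w∈ , _ , forcer~ w∈ , new∉B w∈)

    -- The only unfilled neighbour of a forcer is filled in this round. Hence the two cases of
    -- `back` cannot collide.
    spent : ∀ {x w} → x ∈ frontier (step G B) → w ∈ new → x ≢ forcer w
    spent {w = w} x∈ w∈ refl with _ , y , xy , y∉ ← on x∈ =
      y∉ (q⊆p∪q B new (subst (_∈ new) (sym (forcer-unique w∈ xy (y∉ ∘ p⊆p∪q new))) w∈))

    inj : ∀ {x y} → x ∈ frontier (step G B) → y ∈ frontier (step G B) → back x ≡ back y → x ≡ y
    inj {x} {y} x∈ y∈ eq with x ∈? B | y ∈? B
    ... | yes _  | yes _  = eq
    ... | yes _  | no y∉B = ⊥-elim (spent x∈ (x∉B⇒x∈new y∈ y∉B) eq)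
    ... | no x∉B | yes _  = ⊥-elim (spent y∈ (x∉B⇒x∈new x∈ x∉B) (sym eq))
    ... | no x∉B | no y∉B =
      forcer-injective (x∉B⇒x∈new x∈ x∉B) (x∉B⇒x∈new y∈ y∉B) eq

  newAt : Subset n → ℕ → Subset n
  newAt B i = Round.new G (filled G B i)

  -- The initial frontier lies in `B`, and no later frontier is larger.
  ∣newAt∣≤∣B∣ : ∀ B i → ∣ newAt B i ∣ˢ ℕ.≤ ∣ B ∣ˢ
  ∣newAt∣≤∣B∣ B i = ℕ.≤-trans (∣new∣≤∣frontier∣ (filled G B i)) (∣frontier∣≤∣B∣ i)
    where
    ∣frontier∣≤∣B∣ : ∀ i → ∣ frontier (filled G B i) ∣ˢ ℕ.≤ ∣ B ∣ˢ
    ∣frontier∣≤∣B∣ zero    = p⊆q⇒∣p∣≤∣q∣ (proj₁ ∘ ∈-comprehension⁻ (onFrontier? B))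
    ∣frontier∣≤∣B∣ (suc i) =
      ℕ.≤-trans (∣frontier-step∣≤∣frontier∣ (filled G B i)) (∣frontier∣≤∣B∣ i)

  -- The inductive step of `largest-round`: `g` is the size of the largest round so far and `f` the
  -- size after the comparison with the next one, so both outcomes are covered.
  round-bound : ∀ B t f g → ∣ filled G B (suc t) ∣ˢ ℕ.≤ ∣ B ∣ˢ ℕ.+ suc t ℕ.* g → g ℕ.≤ f →
    ∣ newAt B (suc t) ∣ˢ ℕ.≤ f → ∣ filled G B (suc (suc t)) ∣ˢ ℕ.≤ ∣ B ∣ˢ ℕ.+ suc (suc t) ℕ.* f
  round-bound B t f g ≤g g≤f new≤f = begin
    ∣ filled G B (suc (suc t)) ∣ˢ
      ≤⟨ ∣p∪q∣≤∣p∣+∣q∣ (filled G B (suc t)) (newAt B (suc t)) ⟩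
    ∣ filled G B (suc t) ∣ˢ ℕ.+ ∣ newAt B (suc t) ∣ˢ
      ≤⟨ ℕ.+-mono-≤ (ℕ.≤-trans ≤g (ℕ.+-monoʳ-≤ ∣ B ∣ˢ (ℕ.*-monoʳ-≤ (suc t) g≤f))) new≤f ⟩
    ∣ B ∣ˢ ℕ.+ suc t ℕ.* f ℕ.+ f
      ≡⟨ trans (ℕ.+-assoc ∣ B ∣ˢ _ f) (cong (∣ B ∣ˢ ℕ.+_) (ℕ.+-comm _ f)) ⟩
    ∣ B ∣ˢ ℕ.+ suc (suc t) ℕ.* f ∎
    where open ℕ.≤-Reasoning

  -- The index `i` is that of a largest round among the first `suc t`, so each of these rounds adds
  -- at most `∣ newAt B i ∣ˢ` vertices.
  largest-round : ∀ B t → ∃ λ i →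
    ∣ filled G B (suc t) ∣ˢ ℕ.≤ ∣ B ∣ˢ ℕ.+ suc t ℕ.* ∣ newAt B i ∣ˢ
  largest-round B zero    = 0 , (begin
    ∣ filled G B 1 ∣ˢ              ≤⟨ ∣p∪q∣≤∣p∣+∣q∣ B (newAt B 0) ⟩
    ∣ B ∣ˢ ℕ.+ ∣ newAt B 0 ∣ˢ       ≡⟨ cong (∣ B ∣ˢ ℕ.+_) (sym (ℕ.*-identityˡ _)) ⟩
    ∣ B ∣ˢ ℕ.+ 1 ℕ.* ∣ newAt B 0 ∣ˢ ∎)
    where open ℕ.≤-Reasoning
  largest-round B (suc t) with largest-round B t
  ... | i , IH with ℕ.≤-total ∣ newAt B i ∣ˢ ∣ newAt B (suc t) ∣ˢ
  ...   | inj₁ i≤t = suc t , round-bound B t _ _ IH i≤t ℕ.≤-refl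
  ...   | inj₂ t≤i = i , round-bound B t _ _ IH ℕ.≤-refl t≤i

-- (k − f)t ≥ 0
k+tf≤kt+f : ∀ {k f} t → f ℕ.≤ k → k ℕ.+ suc t ℕ.* f ℕ.≤ k ℕ.* suc t ℕ.+ f
k+tf≤kt+f {k} {f} t f≤k = begin
  k ℕ.+ suc t ℕ.* f       ≡⟨ lemma k f t ⟩
  k ℕ.+ f ℕ.+ t ℕ.* f     ≤⟨ ℕ.+-monoʳ-≤ (k ℕ.+ f) (ℕ.*-monoʳ-≤ t f≤k) ⟩
  k ℕ.+ f ℕ.+ t ℕ.* k     ≡⟨ lemma′ k f t ⟩
  k ℕ.* suc t ℕ.+ f       ∎
  where
  open ℕ.≤-Reasoning
  lemma : ∀ k f t → k ℕ.+ suc t ℕ.* f ≡ k ℕ.+ f ℕ.+ t ℕ.* f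
  lemma = solve-∀
  lemma′ : ∀ k f t → k ℕ.+ f ℕ.+ t ℕ.* k ≡ k ℕ.* suc t ℕ.+ f
  lemma′ = solve-∀

-- From throttling numbers to cross matchings

th*⇒matching : (G : Graph n) (e : HasEdge G) →
  ∃ λ m → CrossMatching (Adj G) m × n ℕ.≤ th* G e ℕ.+ m
th*⇒matching {n} G e with th*-attained G e
-- Time 0 would make `B` the whole vertex set, against `∣ B ∣ˢ < n`.
... | B , zero  , th≡ , _ , B<n , full =
  ⊥-elim (ℕ.<⇒≢ B<n (trans (cong ∣_∣ˢ full) (∣⊤∣≡n n)))
... | B , suc t , th≡ , _ , B<n , full with i , ≤i ← largest-round G B t =
  ∣ newAt G B i ∣ˢ , Round.matching G (filled G B i) , (begin
    n                                       ≡⟨ trans (cong ∣_∣ˢ full) (∣⊤∣≡n n) ⟨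
    ∣ filled G B (suc t) ∣ˢ                  ≤⟨ ≤i ⟩
    ∣ B ∣ˢ ℕ.+ suc t ℕ.* ∣ newAt G B i ∣ˢ     ≤⟨ k+tf≤kt+f t (∣newAt∣≤∣B∣ G B i) ⟩
    ∣ B ∣ˢ ℕ.* suc t ℕ.+ ∣ newAt G B i ∣ˢ     ≡⟨ cong (ℕ._+ ∣ newAt G B i ∣ˢ) th≡ ⟨
    th* G e ℕ.+ ∣ newAt G B i ∣ˢ             ∎)
  where open ℕ.≤-Reasoning

-- Matchings in a graph and in its complement

open CrossMatching

module _ {G : Graph n} {m m′ : ℕ}
  (M : CrossMatching (Adj G) m) (N : CrossMatching (Adj (complement G)) m′) where

  -- Every other vertex is adjacent to x in G or in the complement, and each
  -- alternative leaves room for a single vertex of V M ∩ V N.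
  ∣U∩U∣≤2⊎∣V∩V∣≤2 : ∣ U M ∩ U N ∣ˢ ℕ.≤ 2 ⊎ ∣ V M ∩ V N ∣ˢ ℕ.≤ 2
  ∣U∩U∣≤2⊎∣V∩V∣≤2 with nonempty? (U M ∩ U N)
  ... | no ¬x = inj₁ (Empty⇒∣p∣≤k 2 ¬x)
  ... | yes (x , x∈) with x∈UM , x∈UN ← x∈p∩q⁻ (U M) (U N) x∈ =
    inj₂ (injection⇒∣p∣≤∣q∣ side (V M ∩ V N) (⊤ {2}) (λ _ → ∈⊤) inj)
    where
    side : Fin n → Fin 2
    side y with adj? G x y
    ... | yes _ = zero
    ... | no _  = suc zero

    inj : ∀ {y z} → y ∈ V M ∩ V N → z ∈ V M ∩ V N → side y ≡ side z → y ≡ z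
    inj {y} {z} y∈ z∈ eq
      with y∈VM , y∈VN ← x∈p∩q⁻ (V M) (V N) y∈ | z∈VM , z∈VN ← x∈p∩q⁻ (V M) (V N) z∈
      with adj? G x y | adj? G x z
    ... | yes xy | yes xz = uniqueᵛ M x∈UM y∈VM z∈VM xy xz
    ... | no ¬xy | no ¬xz = uniqueᵛ N x∈UN y∈VN z∈VN
      ((λ { refl → disjoint N x∈UN y∈VN }) , ¬xy) ((λ { refl → disjoint N x∈UN z∈VN }) , ¬xz)

-- Here `P` will be one side of the other matching. It meets `U N ∪ V N`, a set of at least 2m
-- vertices, in at most 2 + 2 vertices, and inclusion-exclusion does the rest.
k+2m≤n+4 : ∀ {R : Rel (Fin n) 0ℓ} {k} (N : CrossMatching R m) (P : Subset n) → k ℕ.≤ ∣ P ∣ˢ →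
  ∣ P ∩ U N ∣ˢ ℕ.≤ 2 → ∣ P ∩ V N ∣ˢ ℕ.≤ 2 → k ℕ.+ (m ℕ.+ m) ℕ.≤ n ℕ.+ 4
k+2m≤n+4 {n} {m} {k = k} N P k≤∣P∣ PU≤2 PV≤2 = begin
  k ℕ.+ (m ℕ.+ m)                          ≤⟨ ℕ.+-mono-≤ k≤∣P∣ (ℕ.+-mono-≤ (m≤∣U∣ N) (m≤∣V∣ N)) ⟩
  ∣ P ∣ˢ ℕ.+ (∣ U N ∣ˢ ℕ.+ ∣ V N ∣ˢ)          ≡⟨ cong (∣ P ∣ˢ ℕ.+_) ∣U∪V∣ ⟨
  ∣ P ∣ˢ ℕ.+ ∣ U N ∪ V N ∣ˢ                  ≤⟨ ∣p∣+∣q∣≤n+∣p∩q∣ P (U N ∪ V N) ⟩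
  n ℕ.+ ∣ P ∩ (U N ∪ V N) ∣ˢ                ≡⟨ cong (λ S → n ℕ.+ ∣ S ∣ˢ) (∩-distribˡ-∪ P (U N) (V N)) ⟩
  n ℕ.+ ∣ (P ∩ U N) ∪ (P ∩ V N) ∣ˢ          ≤⟨ ℕ.+-monoʳ-≤ n (∣p∪q∣≤∣p∣+∣q∣ (P ∩ U N) (P ∩ V N)) ⟩
  n ℕ.+ (∣ P ∩ U N ∣ˢ ℕ.+ ∣ P ∩ V N ∣ˢ)      ≤⟨ ℕ.+-monoʳ-≤ n (ℕ.+-mono-≤ PU≤2 PV≤2) ⟩
  n ℕ.+ 4                                  ∎
  where
  open ℕ.≤-Reasoning
  ∣U∩V∣≡0 : ∣ U N ∩ V N ∣ˢ ≡ 0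
  ∣U∩V∣≡0 = ℕ.n≤0⇒n≡0 (Empty⇒∣p∣≤k 0 λ (x , x∈) →
    let x∈U , x∈V = x∈p∩q⁻ (U N) (V N) x∈ in disjoint N x∈U x∈V)
  ∣U∪V∣ : ∣ U N ∪ V N ∣ˢ ≡ ∣ U N ∣ˢ ℕ.+ ∣ V N ∣ˢ
  ∣U∪V∣ = trans (sym (trans (cong (∣ U N ∪ V N ∣ˢ ℕ.+_) ∣U∩V∣≡0) (ℕ.+-identityʳ _)))
                (∣p∪q∣+∣p∩q∣≡∣p∣+∣q∣ (U N) (V N))

∣p∩q∣≤k⇒∣q∩p∣≤k : ∀ {k} (p q : Subset n) → ∣ p ∩ q ∣ˢ ℕ.≤ k → ∣ q ∩ p ∣ˢ ℕ.≤ k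
∣p∩q∣≤k⇒∣q∩p∣≤k {k = k} p q = subst (λ S → ∣ S ∣ˢ ℕ.≤ k) (∩-comm p q)

-- One of `U M ∩ U N`, `V M ∩ V N` is small, and one of `U M ∩ V N`, `V M ∩ U N`. Any choice of one
-- from each pair has a side in common, and that side nearly avoids both sides of the other
-- matching.
matching-sizes : ∀ {m m′} {G : Graph n} →
  CrossMatching (Adj G) m → CrossMatching (Adj (complement G)) m′ →
  m′ ℕ.+ (m ℕ.+ m) ℕ.≤ n ℕ.+ 4 ⊎ m ℕ.+ (m′ ℕ.+ m′) ℕ.≤ n ℕ.+ 4
matching-sizes {G = G} M N
  with ∣U∩U∣≤2⊎∣V∩V∣≤2 {G = G} M N | ∣U∩U∣≤2⊎∣V∩V∣≤2 {G = G} M (swap N)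
... | inj₁ UU | inj₁ UV = inj₂ (k+2m≤n+4 N (U M) (m≤∣U∣ M) UU UV)
... | inj₂ VV | inj₂ VU = inj₂ (k+2m≤n+4 N (V M) (m≤∣V∣ M) VU VV)
... | inj₁ UU | inj₂ VU = inj₁ (k+2m≤n+4 M (U N) (m≤∣U∣ N) (∣p∩q∣≤k⇒∣q∩p∣≤k (U M) (U N) UU)
      (∣p∩q∣≤k⇒∣q∩p∣≤k (V M) (U N) VU))
... | inj₂ VV | inj₁ UV = inj₁ (k+2m≤n+4 M (V N) (m≤∣V∣ N) (∣p∩q∣≤k⇒∣q∩p∣≤k (U M) (V N) UV)
      (∣p∩q∣≤k⇒∣q∩p∣≤k (V M) (V N) VV))

-- The product inequality

-- (3m − p)(3p − m) ≥ 0
3pp+3mm≤10mp : ∀ p m → m ℕ.≤ 3 ℕ.* p → p ℕ.≤ 3 ℕ.* m →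
  p ℕ.* (3 ℕ.* p) ℕ.+ m ℕ.* (3 ℕ.* m) ℕ.≤ m ℕ.* p ℕ.+ (3 ℕ.* m) ℕ.* (3 ℕ.* p)
3pp+3mm≤10mp p m m≤3p p≤3m
  with f , 3p≡ ← ℕ.m≤n⇒∃[o]m+o≡n m≤3p | e , 3m≡ ← ℕ.m≤n⇒∃[o]m+o≡n p≤3m
  rewrite sym 3p≡ | sym 3m≡ = subst (p ℕ.* (m ℕ.+ f) ℕ.+ m ℕ.* (p ℕ.+ e) ℕ.≤_)
    (identity p m e f) (ℕ.m≤m+n _ (e ℕ.* f))
  where
  identity : ∀ p m e f → p ℕ.* (m ℕ.+ f) ℕ.+ m ℕ.* (p ℕ.+ e) ℕ.+ e ℕ.* f
    ≡ m ℕ.* p ℕ.+ (p ℕ.+ e) ℕ.* (m ℕ.+ f)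
  identity = solve-∀

-- The cases meet at m = n/4. Below it, p ≥ 3n/4 and q ≥ n/2 suffice. Above it, p ≤ 3m and m ≤ 3p
-- give 3(m + p)² ≤ 16mp = 8p(2m), and the last hypothesis says 2m ≤ q + 4; the 4 costs 32p ≤ 32n.
product-bound-core : ∀ n m m′ p q → n ≡ m ℕ.+ p → n ≡ m′ ℕ.+ q →
  m ℕ.+ m ℕ.≤ n → m′ ℕ.+ m′ ℕ.≤ n → m′ ℕ.+ (m ℕ.+ m) ℕ.≤ n ℕ.+ 4 →
  3 ℕ.* (n ℕ.* n) ℕ.≤ 8 ℕ.* (p ℕ.* q) ℕ.+ 32 ℕ.* n
product-bound-core n m m′ p q n≡m+p n≡m′+q 2m≤n 2m′≤n bound with ℕ.≤-total (4 ℕ.* m) n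
... | inj₁ 4m≤n = begin
  3 ℕ.* (n ℕ.* n)                  ≡⟨ ℕ.*-assoc 3 n n ⟨
  3 ℕ.* n ℕ.* n                    ≤⟨ ℕ.*-mono-≤ 3n≤4p n≤2q ⟩
  4 ℕ.* p ℕ.* (2 ℕ.* q)            ≡⟨ regroup p q ⟩
  8 ℕ.* (p ℕ.* q)                  ≤⟨ ℕ.m≤m+n _ (32 ℕ.* n) ⟩
  8 ℕ.* (p ℕ.* q) ℕ.+ 32 ℕ.* n     ∎
  where
  open ℕ.≤-Reasoning
  regroup : ∀ p q → 4 ℕ.* p ℕ.* (2 ℕ.* q) ≡ 8 ℕ.* (p ℕ.* q)
  regroup = solve-∀
  3n≤4p : 3 ℕ.* n ℕ.≤ 4 ℕ.* p
  3n≤4p = ℕ.+-cancelˡ-≤ n _ _ (begin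
    4 ℕ.* n                ≡⟨ cong (4 ℕ.*_) n≡m+p ⟩
    4 ℕ.* (m ℕ.+ p)        ≡⟨ ℕ.*-distribˡ-+ 4 m p ⟩
    4 ℕ.* m ℕ.+ 4 ℕ.* p    ≤⟨ ℕ.+-monoˡ-≤ (4 ℕ.* p) 4m≤n ⟩
    n ℕ.+ 4 ℕ.* p          ∎)
  n≤2q : n ℕ.≤ 2 ℕ.* q
  n≤2q = begin
    n                ≡⟨ n≡m′+q ⟩
    m′ ℕ.+ q         ≤⟨ ℕ.+-monoˡ-≤ q (ℕ.+-cancelˡ-≤ m′ _ _ (subst (m′ ℕ.+ m′ ℕ.≤_) n≡m′+q 2m′≤n)) ⟩
    q ℕ.+ q          ≡⟨ cong (q ℕ.+_) (ℕ.+-identityʳ q) ⟨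
    2 ℕ.* q          ∎
... | inj₂ n≤4m = begin
  3 ℕ.* (n ℕ.* n)                                              ≡⟨ cong (λ x → 3 ℕ.* (x ℕ.* x)) n≡m+p ⟩
  3 ℕ.* ((m ℕ.+ p) ℕ.* (m ℕ.+ p))                              ≡⟨ expand m p ⟩
  p ℕ.* (3 ℕ.* p) ℕ.+ m ℕ.* (3 ℕ.* m) ℕ.+ 6 ℕ.* (m ℕ.* p)      ≤⟨ ℕ.+-monoˡ-≤ (6 ℕ.* (m ℕ.* p)) (3pp+3mm≤10mp p m m≤3p p≤3m) ⟩
  m ℕ.* p ℕ.+ 3 ℕ.* m ℕ.* (3 ℕ.* p) ℕ.+ 6 ℕ.* (m ℕ.* p)        ≡⟨ collect m p ⟩
  8 ℕ.* (p ℕ.* (m ℕ.+ m))                                      ≤⟨ ℕ.*-monoʳ-≤ 8 (ℕ.*-monoʳ-≤ p 2m≤q+4) ⟩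
  8 ℕ.* (p ℕ.* (q ℕ.+ 4))                                      ≡⟨ distribute p q ⟩
  8 ℕ.* (p ℕ.* q) ℕ.+ 32 ℕ.* p                                 ≤⟨ ℕ.+-monoʳ-≤ (8 ℕ.* (p ℕ.* q)) (ℕ.*-monoʳ-≤ 32 p≤n) ⟩
  8 ℕ.* (p ℕ.* q) ℕ.+ 32 ℕ.* n                                 ∎
  where
  open ℕ.≤-Reasoning
  expand : ∀ m p → 3 ℕ.* ((m ℕ.+ p) ℕ.* (m ℕ.+ p))
    ≡ p ℕ.* (3 ℕ.* p) ℕ.+ m ℕ.* (3 ℕ.* m) ℕ.+ 6 ℕ.* (m ℕ.* p)
  expand = solve-∀
  collect : ∀ m p → m ℕ.* p ℕ.+ 3 ℕ.* m ℕ.* (3 ℕ.* p) ℕ.+ 6 ℕ.* (m ℕ.* p) ≡ 8 ℕ.* (p ℕ.* (m ℕ.+ m))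
  collect = solve-∀
  distribute : ∀ p q → 8 ℕ.* (p ℕ.* (q ℕ.+ 4)) ≡ 8 ℕ.* (p ℕ.* q) ℕ.+ 32 ℕ.* p
  distribute = solve-∀
  p≤n : p ℕ.≤ n
  p≤n = subst (p ℕ.≤_) (sym n≡m+p) (ℕ.m≤n+m p m)
  m≤3p : m ℕ.≤ 3 ℕ.* p
  m≤3p = ℕ.≤-trans (ℕ.+-cancelˡ-≤ m _ _ (subst (m ℕ.+ m ℕ.≤_) n≡m+p 2m≤n)) (ℕ.m≤n*m p 3)
  p≤3m : p ℕ.≤ 3 ℕ.* m
  p≤3m = ℕ.+-cancelˡ-≤ m _ _ (subst (ℕ._≤ 4 ℕ.* m) n≡m+p n≤4m)
  2m≤q+4 : m ℕ.+ m ℕ.≤ q ℕ.+ 4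
  2m≤q+4 = ℕ.+-cancelˡ-≤ m′ _ _
    (ℕ.≤-trans bound (ℕ.≤-reflexive (trans (cong (ℕ._+ 4) n≡m′+q) (ℕ.+-assoc m′ q 4))))

-- Throttling numbers are only bounded below by the differences n - m and n - m′, to which
-- `product-bound-core` applies; the product is monotone in them.
product-bound : ∀ n m m′ a b → n ℕ.≤ a ℕ.+ m → n ℕ.≤ b ℕ.+ m′ →
  m ℕ.+ m ℕ.≤ n → m′ ℕ.+ m′ ℕ.≤ n → m′ ℕ.+ (m ℕ.+ m) ℕ.≤ n ℕ.+ 4 →
  3 ℕ.* (n ℕ.* n) ℕ.≤ 8 ℕ.* (a ℕ.* b) ℕ.+ 32 ℕ.* n
product-bound n m m′ a b n≤a+m n≤b+m′ 2m≤n 2m′≤n bound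
  with p , m+p≡n ← ℕ.m≤n⇒∃[o]m+o≡n (ℕ.m+n≤o⇒m≤o m 2m≤n)
     | q , m′+q≡n ← ℕ.m≤n⇒∃[o]m+o≡n (ℕ.m+n≤o⇒m≤o m′ 2m′≤n) =
  ℕ.≤-trans (product-bound-core n m m′ p q (sym m+p≡n) (sym m′+q≡n) 2m≤n 2m′≤n bound)
    (ℕ.+-monoˡ-≤ (32 ℕ.* n) (ℕ.*-monoʳ-≤ 8
      (ℕ.*-mono-≤ {p} {a} {q} {b} (below m+p≡n n≤a+m) (below m′+q≡n n≤b+m′))))
  where
  below : ∀ {x y c} → x ℕ.+ y ≡ n → n ℕ.≤ c ℕ.+ x → y ℕ.≤ c
  below {x} {y} {c} x+y≡n n≤c+x = ℕ.+-cancelˡ-≤ x y c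
    (ℕ.≤-trans (ℕ.≤-reflexive x+y≡n) (subst (n ℕ.≤_) (ℕ.+-comm c x) n≤c+x))

3n²≤8th*th*+32n : (G : Graph n) (e : HasEdge G) (e′ : HasEdge (complement G)) →
  3 ℕ.* (n ℕ.* n) ℕ.≤ 8 ℕ.* (th* G e ℕ.* th* (complement G) e′) ℕ.+ 32 ℕ.* n
3n²≤8th*th*+32n {n} G e e′
  with m , M , n≤a+m ← th*⇒matching G e
     | m′ , N , n≤b+m′ ← th*⇒matching (complement G) e′
  with matching-sizes {G = G} M N
... | inj₁ bound = product-bound n m m′ _ _ n≤a+m n≤b+m′ (m+m≤n M) (m+m≤n N) bound
-- The same bound with the graph and its complement exchanged.
... | inj₂ bound = subst (λ x → 3 ℕ.* (n ℕ.* n) ℕ.≤ 8 ℕ.* x ℕ.+ 32 ℕ.* n) (ℕ.*-comm (th* (complement G) e′) (th* G e))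
  (product-bound n m′ m _ _ n≤b+m′ n≤a+m (m+m≤n N) (m+m≤n M) bound)

-- Upper bounds from forcing in one round

module _ {m n : ℕ} (G : Graph n) (e : HasEdge G) (u v : Fin m → Fin n)
  (u~v : ∀ i → Adj G (u i) (v i)) (u~v⇒≡ : ∀ {i j} → Adj G (u i) (v j) → i ≡ j)
  (u≢v : ∀ i j → u i ≢ v j) where

  private
    image? : ∀ x → Dec (∃ λ i → v i ≡ x)
    image? x = any? λ i → v i ≟ᶠ x

    image B : Subset n
    image = comprehension image?
    B = ∁ image

    ∈image : ∀ i → v i ∈ image
    ∈image i = ∈-comprehension⁺ image? (i , refl)

    u∈B : ∀ i → u i ∈ B
    u∈B i = x∉p⇒x∈∁p λ ui∈ → let j , eq = ∈-comprehension⁻ image? ui∈ in u≢v i j (sym eq)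

    forces : ∀ i → Forces G B (u i) (v i)
    forces i = u∈B i , u~v i , x∈p⇒x∉∁p (∈image i) , unique
      where
      unique : ∀ x → Adj G (u i) x → x ∉ B → x ≡ v i
      unique x ux x∉B with j , refl ← ∈-comprehension⁻ image? (x∉∁p⇒x∈p x∉B) =
        cong v (sym (u~v⇒≡ ux))

    full : step G B ≡ ⊤
    full = ⊆-antisym (λ _ → ∈⊤) λ {x} _ → x∈p∪q⁺ (in-step x)
      where
      in-step : ∀ x → x ∈ B ⊎ x ∈ comprehension (forced? G B)
      in-step x with x ∈? B
      ... | yes x∈B = inj₁ x∈B
      ... | no x∉B with i , refl ← ∈-comprehension⁻ image? (x∉∁p⇒x∈p x∉B) =
        inj₂ (∈-comprehension⁺ (forced? G B) (u i , forces i))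

    m≤∣image∣ : m ℕ.≤ ∣ image ∣ˢ
    m≤∣image∣ = subst (ℕ._≤ ∣ image ∣ˢ) (∣⊤∣≡n m)
      (injection⇒∣p∣≤∣q∣ v ⊤ image (λ {i} _ → ∈image i)
        -- If `v i` and `v j` coincide, then `u i` is adjacent to `v j`, which forces i = j.
        λ {i} {j} _ _ eq → u~v⇒≡ (subst (Adj G (u i)) eq (u~v i)))

    ∣B∣+∣image∣≡n : ∣ B ∣ˢ ℕ.+ ∣ image ∣ˢ ≡ n
    ∣B∣+∣image∣≡n = trans (cong (ℕ._+ ∣ image ∣ˢ) (∣∁p∣≡n∸∣p∣ image)) (ℕ.m∸n+n≡m (∣p∣≤n image))

    0<∣p∣ : ∀ {x} {p : Subset n} → x ∈ p → 0 ℕ.< ∣ p ∣ˢ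
    0<∣p∣ x∈p = ℕ.≤-<-trans z≤n (x∈p⇒∣p-x∣<∣p∣ x∈p)

  -- Fill everything except the `v i`: each `u i` then has `v i` as its only unfilled neighbour, so
  -- one round suffices. The given index shows that this set is nonempty and proper, as an
  -- admissible size requires.
  th*+matching≤n : Fin m → th* G e ℕ.+ m ℕ.≤ n
  th*+matching≤n i = begin
    th* G e ℕ.+ m            ≤⟨ ℕ.+-mono-≤ (th*-≤ G e B 1 (0<∣p∣ (u∈B i)) B<n full) m≤∣image∣ ⟩
    ∣ B ∣ˢ ℕ.* 1 ℕ.+ ∣ image ∣ˢ ≡⟨ cong (ℕ._+ ∣ image ∣ˢ) (ℕ.*-identityʳ ∣ B ∣ˢ) ⟩
    ∣ B ∣ˢ ℕ.+ ∣ image ∣ˢ       ≡⟨ ∣B∣+∣image∣≡n ⟩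
    n                        ∎
    where
    open ℕ.≤-Reasoning
    B<n : ∣ B ∣ˢ ℕ.< n
    B<n = begin-strict
      ∣ B ∣ˢ                  <⟨ ℕ.m<m+n ∣ B ∣ˢ (0<∣p∣ (∈image i)) ⟩
      ∣ B ∣ˢ ℕ.+ ∣ image ∣ˢ     ≡⟨ ∣B∣+∣image∣≡n ⟩
      n                      ∎

-- The extremal graphs

module _ (k : ℕ) where

  -- The vertices are (p , s) with p = (i , c): those with s = 0 form an
  -- independent set, those with s = 1 a perfect matching (i , 0) ~ (i , 1),
  -- and the two sides are joined completely except for p ~ p.
  PairAdj : Rel (Fin (k ℕ.* 2) × Fin 2) 0ℓ
  PairAdj (p , zero)     (q , zero)     = ⊥ᵗ
  PairAdj (p , zero)     (q , suc zero) = p ≢ q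
  PairAdj (p , suc zero) (q , zero)     = p ≢ q
  PairAdj (p , suc zero) (q , suc zero) = p ≢ q × quotient {k} 2 p ≡ quotient 2 q

  pairAdj? : ∀ x y → Dec (PairAdj x y)
  pairAdj? (p , zero)     (q , zero)     = no λ ()
  pairAdj? (p , zero)     (q , suc zero) = ¬? (p ≟ᶠ q)
  pairAdj? (p , suc zero) (q , zero)     = ¬? (p ≟ᶠ q)
  pairAdj? (p , suc zero) (q , suc zero) = ¬? (p ≟ᶠ q) ×-dec (quotient {k} 2 p ≟ᶠ quotient 2 q)

  pairAdj-sym : ∀ x y → PairAdj x y → PairAdj y x
  pairAdj-sym (p , zero)     (q , suc zero) p≢q       = p≢q ∘ sym
  pairAdj-sym (p , suc zero) (q , zero)     p≢q       = p≢q ∘ sym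
  pairAdj-sym (p , suc zero) (q , suc zero) (p≢q , ≡) = p≢q ∘ sym , sym ≡

  pairAdj-irrefl : ∀ x → ¬ PairAdj x x
  pairAdj-irrefl (p , suc zero) (p≢p , _) = p≢p refl

  order : ℕ
  order = k ℕ.* 2 ℕ.* 2

  decode : Fin order → Fin (k ℕ.* 2) × Fin 2
  decode = remQuot {k ℕ.* 2} 2

  extremal : Graph order
  extremal .Adj x y        = PairAdj (decode x) (decode y)
  extremal .adj? x y       = pairAdj? (decode x) (decode y)
  extremal .adj-sym {x} {y} = pairAdj-sym (decode x) (decode y)
  extremal .adj-irrefl {x} refl = pairAdj-irrefl (decode x)

  vertex : Fin (k ℕ.* 2) → Fin 2 → Fin order
  vertex = combine

  adj-vertex⁺ : ∀ {p q s t} → PairAdj (p , s) (q , t) → Adj extremal (vertex p s) (vertex q t)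
  adj-vertex⁺ {p} {q} {s} {t} = subst₂ PairAdj (sym (remQuot-combine p s)) (sym (remQuot-combine q t))

  adj-vertex⁻ : ∀ {p q s t} → Adj extremal (vertex p s) (vertex q t) → PairAdj (p , s) (q , t)
  adj-vertex⁻ {p} {q} {s} {t} = subst₂ PairAdj (remQuot-combine p s) (remQuot-combine q t)

  vertex-injective : ∀ {p q s t} → vertex p s ≡ vertex q t → p ≡ q × s ≡ t
  vertex-injective {p} {q} {s} {t} = combine-injective p s q t

  coadj-vertex : ∀ {p q s t} → (p , s) ≢ (q , t) → ¬ PairAdj (p , s) (q , t) →
    Adj (complement extremal) (vertex p s) (vertex q t)
  coadj-vertex ≢ ¬pq =
    (λ eq → ≢ (let p≡q , s≡t = vertex-injective eq in cong₂ _,_ p≡q s≡t)) , ¬pq ∘ adj-vertex⁻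

  -- The matching used is the one inside the half s = 1, with k = n/4 edges.
  th*-extremal-≤ : (e : HasEdge extremal) → Fin k → th* extremal e ℕ.+ k ℕ.≤ order
  th*-extremal-≤ e = th*+matching≤n extremal e u v u~v u~v⇒≡ u≢v
    where
    u v : Fin k → Fin order
    u i = vertex (combine i zero) (suc zero)
    v i = vertex (combine i (suc zero)) (suc zero)

    combine-0≢1 : ∀ i j → combine {k} {2} i zero ≢ combine j (suc zero)
    combine-0≢1 i j eq = case proj₂ (combine-injective i zero j (suc zero) eq) of λ ()

    quotient-combine : ∀ i (c : Fin 2) → quotient {k} 2 (combine i c) ≡ i
    quotient-combine i c = cong proj₁ (remQuot-combine i c)

    u~v : ∀ i → Adj extremal (u i) (v i)
    u~v i = adj-vertex⁺ (combine-0≢1 i i , trans (quotient-combine i zero) (sym (quotient-combine i (suc zero))))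

    u~v⇒≡ : ∀ {i j} → Adj extremal (u i) (v j) → i ≡ j
    u~v⇒≡ {i} {j} ij with _ , eq ← adj-vertex⁻ ij =
      trans (sym (quotient-combine i zero)) (trans eq (quotient-combine j (suc zero)))

    u≢v : ∀ i j → u i ≢ v j
    u≢v i j eq = combine-0≢1 i j (proj₁ (vertex-injective eq))

  -- In the complement the two halves are joined exactly by the edges between `(p , 0)` and
  -- `(p , 1)`, a perfect matching with 2k = n/2 edges.
  th*-co-extremal-≤ : (e : HasEdge (complement extremal)) → Fin (k ℕ.* 2) →
    th* (complement extremal) e ℕ.+ k ℕ.* 2 ℕ.≤ order
  th*-co-extremal-≤ e = th*+matching≤n (complement extremal) e
    (λ p → vertex p zero) (λ p → vertex p (suc zero))
    (λ p → coadj-vertex (λ ()) λ p≢p → p≢p refl)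
    -- Non-adjacency across the halves of `extremal` is the double negation of p = q.
    (λ {p} {q} (_ , ¬pq) → decidable-stable (p ≟ᶠ q) (¬pq ∘ adj-vertex⁺))
    (λ p q eq → case proj₂ (vertex-injective eq) of λ ())

  connected-from-vertices : ∀ {R : Rel (Fin order) 0ℓ} →
    (∀ p s q t → Star R (vertex p s) (vertex q t)) → ∀ x y → Star R x y
  connected-from-vertices {R} path x y =
    subst₂ (Star R) (combine-remQuot {k ℕ.* 2} 2 x) (combine-remQuot {k ℕ.* 2} 2 y)
      (path (proj₁ (decode x)) (proj₂ (decode x)) (proj₁ (decode y)) (proj₂ (decode y)))

  -- Across the halves only the edges from p to p are missing, so an index `r` other than `p` and
  -- `q` gives a common neighbour to two vertices of the same half.
  extremal-connected : (∀ p q → ∃ λ r → p ≢ r × q ≢ r) → Connected extremal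
  extremal-connected third = connected-from-vertices path
    where
    step₀₁ : ∀ {p q} → p ≢ q → Star (Adj extremal) (vertex p zero) (vertex q (suc zero))
    step₀₁ p≢q = adj-vertex⁺ p≢q ◅ stay

    step₁₀ : ∀ {p q} → p ≢ q → Star (Adj extremal) (vertex p (suc zero)) (vertex q zero)
    step₁₀ p≢q = adj-vertex⁺ p≢q ◅ stay

    path₀₀ : ∀ p q → Star (Adj extremal) (vertex p zero) (vertex q zero)
    path₀₀ p q with r , p≢r , q≢r ← third p q = step₀₁ p≢r ◅◅ step₁₀ (q≢r ∘ sym)

    path : ∀ p s q t → Star (Adj extremal) (vertex p s) (vertex q t)
    path p zero       q zero       = path₀₀ p q
    path p zero       q (suc zero) with r , q≢r , _ ← third q q = path₀₀ p r ◅◅ step₀₁ (q≢r ∘ sym)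
    path p (suc zero) q zero       with r , p≢r , _ ← third p p = step₁₀ p≢r ◅◅ path₀₀ r q
    path p (suc zero) q (suc zero)
      with r , p≢r , q≢r ← third p q = step₁₀ p≢r ◅◅ step₀₁ (q≢r ∘ sym)

  -- The half s = 0 is a clique in the complement, and each `(p , 1)` is attached to `(p , 0)`.
  co-extremal-connected : Connected (complement extremal)
  co-extremal-connected = connected-from-vertices path
    where
    path₀₀ : ∀ p q → Star (Adj (complement extremal)) (vertex p zero) (vertex q zero)
    path₀₀ p q with p ≟ᶠ q
    ... | yes refl = stay
    ... | no p≢q   = coadj-vertex (p≢q ∘ cong proj₁) id ◅ stay

    down : ∀ p s → Star (Adj (complement extremal)) (vertex p s) (vertex p zero)
    down p zero       = stay
    down p (suc zero) = coadj-vertex (λ ()) (λ p≢p → p≢p refl) ◅ stay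

    up : ∀ p s → Star (Adj (complement extremal)) (vertex p zero) (vertex p s)
    up p zero       = stay
    up p (suc zero) = coadj-vertex (λ ()) (λ p≢p → p≢p refl) ◅ stay

    path : ∀ p s q t → Star (Adj (complement extremal)) (vertex p s) (vertex q t)
    path p s q t = down p s ◅◅ path₀₀ p q ◅◅ up q t

third-element : ∀ {n} (p q : Fin (3 ℕ.+ n)) → ∃ λ r → p ≢ r × q ≢ r
third-element zero          zero          = suc zero , (λ ()) , (λ ())
third-element zero          (suc zero)    = suc (suc zero) , (λ ()) , (λ ())
third-element zero          (suc (suc q)) = suc zero , (λ ()) , (λ ())
third-element (suc zero)    zero          = suc (suc zero) , (λ ()) , (λ ())
third-element (suc (suc p)) zero          = suc zero , (λ ()) , (λ ())
third-element (suc p)       (suc q)       = zero , (λ ()) , (λ ())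

-- Rational arithmetic

-- The division in `fromℕ` normalises by a gcd and is stuck on a variable `k`; the unnormalised
-- fraction k/1 computes.
toℚᵘ-fromℕ : ∀ k → toℚᵘ (fromℕ k) ℚᵘ.≃ mkℚᵘ (+ k) 0
toℚᵘ-fromℕ k = ℚ.toℚᵘ-fromℚᵘ (mkℚᵘ (+ k) 0)

fromℕ-+ : ∀ a b → fromℕ (a ℕ.+ b) ≡ fromℕ a + fromℕ b
fromℕ-+ a b = ℚ.toℚᵘ-injective (begin
  toℚᵘ (fromℕ (a ℕ.+ b))                    ≈⟨ toℚᵘ-fromℕ (a ℕ.+ b) ⟩
  mkℚᵘ (+ (a ℕ.+ b)) 0                      ≈⟨ *≡* (cong (ℤ._* + 1)
                                                (cong₂ ℤ._+_ (ℤ.*-identityʳ (+ a)) (ℤ.*-identityʳ (+ b)))) ⟨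
  mkℚᵘ (+ a) 0 ℚᵘ.+ mkℚᵘ (+ b) 0            ≈⟨ ℚᵘ.+-cong (toℚᵘ-fromℕ a) (toℚᵘ-fromℕ b) ⟨
  toℚᵘ (fromℕ a) ℚᵘ.+ toℚᵘ (fromℕ b)        ≈⟨ ℚ.toℚᵘ-homo-+ (fromℕ a) (fromℕ b) ⟨
  toℚᵘ (fromℕ a + fromℕ b)                  ∎)
  where open ℚᵘ.≃-Reasoning

fromℕ-* : ∀ a b → fromℕ (a ℕ.* b) ≡ fromℕ a * fromℕ b
fromℕ-* a b = ℚ.toℚᵘ-injective (begin
  toℚᵘ (fromℕ (a ℕ.* b))                    ≈⟨ toℚᵘ-fromℕ (a ℕ.* b) ⟩
  mkℚᵘ (+ (a ℕ.* b)) 0                      ≈⟨ *≡* (cong (ℤ._* + 1) (ℤ.pos-* a b)) ⟩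
  mkℚᵘ (+ a) 0 ℚᵘ.* mkℚᵘ (+ b) 0            ≈⟨ ℚᵘ.*-cong (toℚᵘ-fromℕ a) (toℚᵘ-fromℕ b) ⟨
  toℚᵘ (fromℕ a) ℚᵘ.* toℚᵘ (fromℕ b)        ≈⟨ ℚ.toℚᵘ-homo-* (fromℕ a) (fromℕ b) ⟨
  toℚᵘ (fromℕ a * fromℕ b)                  ∎)
  where open ℚᵘ.≃-Reasoning

fromℕ-mono-≤ : ∀ {a b} → a ℕ.≤ b → fromℕ a ≤ fromℕ b
fromℕ-mono-≤ {a} {b} a≤b = ℚ.toℚᵘ-cancel-≤ (begin
  toℚᵘ (fromℕ a)  ≃⟨ toℚᵘ-fromℕ a ⟩
  mkℚᵘ (+ a) 0    ≤⟨ *≤* (ℤ.*-monoʳ-≤-nonNeg (+ 1) (ℤ.+≤+ a≤b)) ⟩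
  mkℚᵘ (+ b) 0    ≃⟨ toℚᵘ-fromℕ b ⟨
  toℚᵘ (fromℕ b)  ∎)
  where open ℚᵘ.≤-Reasoning

n^2≡n*n : ∀ n → n ℕ.^ 2 ≡ n ℕ.* n
n^2≡n*n n = cong (n ℕ.*_) (ℕ.*-identityʳ n)

p-q≤r : ∀ p q r → p ≤ r + q → p - q ≤ r
p-q≤r p q r p≤r+q = begin
  p - q        ≤⟨ ℚ.+-monoˡ-≤ (- q) p≤r+q ⟩
  r + q - q    ≡⟨ solve 2 (λ q r → r :+ q :- q := r) refl q r ⟩
  r            ∎
  where
  open ℚ.≤-Reasoning
  open +-*-Solver

3a≤8b+c⇒3/8a≤b+1/8c : ∀ {a b c} → 3 ℕ.* a ℕ.≤ 8 ℕ.* b ℕ.+ c →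
  + 3 / 8 * fromℕ a ≤ fromℕ b + + 1 / 8 * fromℕ c
3a≤8b+c⇒3/8a≤b+1/8c {a} {b} {c} le = begin
  -- The closed term `+ 1 / 8 * fromℕ 3` evaluates to `+ 3 / 8`.
  + 3 / 8 * fromℕ a                           ≡⟨ ℚ.*-assoc (+ 1 / 8) (fromℕ 3) (fromℕ a) ⟩
  + 1 / 8 * (fromℕ 3 * fromℕ a)               ≡⟨ cong (+ 1 / 8 *_) (fromℕ-* 3 a) ⟨
  + 1 / 8 * fromℕ (3 ℕ.* a)                   ≤⟨ ℚ.*-monoˡ-≤-nonNeg (+ 1 / 8) (fromℕ-mono-≤ {3 ℕ.* a} {8 ℕ.* b ℕ.+ c} le) ⟩
  + 1 / 8 * fromℕ (8 ℕ.* b ℕ.+ c)             ≡⟨ cong (+ 1 / 8 *_) (trans (fromℕ-+ (8 ℕ.* b) c) (cong (λ x → x + fromℕ c) (fromℕ-* 8 b))) ⟩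
  + 1 / 8 * (fromℕ 8 * fromℕ b + fromℕ c)     ≡⟨ ℚ.*-distribˡ-+ (+ 1 / 8) (fromℕ 8 * fromℕ b) (fromℕ c) ⟩
  + 1 / 8 * (fromℕ 8 * fromℕ b) + + 1 / 8 * fromℕ c
    ≡⟨ cong (λ x → x + + 1 / 8 * fromℕ c) (trans (sym (ℚ.*-assoc (+ 1 / 8) (fromℕ 8) (fromℕ b))) (ℚ.*-identityˡ (fromℕ b))) ⟩
  fromℕ b + + 1 / 8 * fromℕ c                 ∎
  where open ℚ.≤-Reasoning

3a≤8b+32n⇒3/8a≤b+4n : ∀ {a b} n → 3 ℕ.* a ℕ.≤ 8 ℕ.* b ℕ.+ 32 ℕ.* n →
  + 3 / 8 * fromℕ a ≤ fromℕ b + fromℕ 4 * fromℕ n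
3a≤8b+32n⇒3/8a≤b+4n {a} {b} n le = ℚ.≤-trans (3a≤8b+c⇒3/8a≤b+1/8c {a} {b} le)
  (ℚ.≤-reflexive (cong (λ x → fromℕ b + x)
    (trans (cong (+ 1 / 8 *_) (fromℕ-* 32 n)) (sym (ℚ.*-assoc (+ 1 / 8) (fromℕ 32) (fromℕ n))))))

8b≤3a⇒b≤3/8a : ∀ {a b} → 8 ℕ.* b ℕ.≤ 3 ℕ.* a → fromℕ b ≤ + 3 / 8 * fromℕ a
8b≤3a⇒b≤3/8a {a} {b} le = begin
  fromℕ b                          ≡⟨ ℚ.*-identityˡ (fromℕ b) ⟨
  + 1 / 8 * fromℕ 8 * fromℕ b      ≡⟨ trans (ℚ.*-assoc (+ 1 / 8) (fromℕ 8) (fromℕ b)) (cong (+ 1 / 8 *_) (sym (fromℕ-* 8 b))) ⟩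
  + 1 / 8 * fromℕ (8 ℕ.* b)        ≤⟨ ℚ.*-monoˡ-≤-nonNeg (+ 1 / 8) (fromℕ-mono-≤ {8 ℕ.* b} {3 ℕ.* a} le) ⟩
  + 1 / 8 * fromℕ (3 ℕ.* a)        ≡⟨ cong (+ 1 / 8 *_) (fromℕ-* 3 a) ⟩
  + 1 / 8 * (fromℕ 3 * fromℕ a)    ≡⟨ ℚ.*-assoc (+ 1 / 8) (fromℕ 3) (fromℕ a) ⟨
  + 3 / 8 * fromℕ a                ∎
  where open ℚ.≤-Reasoning

∣p-q∣≤r : ∀ p q r → p - q ≤ r → q - p ≤ r → ∣ p - q ∣ ≤ r
∣p-q∣≤r p q r p-q≤r q-p≤r with ℚ.∣p∣≡p∨∣p∣≡-p (p - q)
... | inj₁ eq = subst (_≤ r) (sym eq) p-q≤r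
... | inj₂ eq = subst (_≤ r) (sym (trans eq (negate p q))) q-p≤r
  where
  open +-*-Solver
  negate : ∀ p q → - (p - q) ≡ q - p
  negate = solve 2 (λ p q → :- (p :- q) := q :- p) refl

archimedean : ∀ ε → 0ℚ < ε → ∀ k → ∃ λ M → fromℕ k ≤ ε * fromℕ M
archimedean ε@(mkℚ (+ zero) _ _) (*<* (ℤ.+<+ ())) k
-- As ε = (p + 1)/(d + 1), multiplying it by k(d + 1) gives k(p + 1), which is at least k.
archimedean ε@(mkℚ +[1+ p ] d _) _ k = k ℕ.* suc d , ℚ.toℚᵘ-cancel-≤ (begin
  toℚᵘ (fromℕ k)                                  ≃⟨ toℚᵘ-fromℕ k ⟩
  mkℚᵘ (+ k) 0                                    ≤⟨ *≤* bound ⟩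
  mkℚᵘ +[1+ p ] d ℚᵘ.* mkℚᵘ (+ (k ℕ.* suc d)) 0   ≃⟨ ℚᵘ.*-congˡ {toℚᵘ ε} (toℚᵘ-fromℕ (k ℕ.* suc d)) ⟨
  toℚᵘ ε ℚᵘ.* toℚᵘ (fromℕ (k ℕ.* suc d))          ≃⟨ ℚ.toℚᵘ-homo-* ε (fromℕ (k ℕ.* suc d)) ⟨
  toℚᵘ (ε * fromℕ (k ℕ.* suc d))                  ∎)
  where
  open ℚᵘ.≤-Reasoning
  bound : + k ℤ.* + (suc d ℕ.* 1) ℤ.≤ +[1+ p ] ℤ.* + (k ℕ.* suc d) ℤ.* + 1
  bound = subst₂ ℤ._≤_ (ℤ.pos-* k (suc d ℕ.* 1))
    (trans (sym (ℤ.*-identityʳ _)) (cong (ℤ._* + 1) (ℤ.pos-* (suc p) (k ℕ.* suc d))))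
    (ℤ.+≤+ (subst (ℕ._≤ suc p ℕ.* (k ℕ.* suc d)) (cong (k ℕ.*_) (sym (ℕ.*-identityʳ (suc d))))
      (ℕ.m≤n*m (k ℕ.* suc d) (suc p))))
archimedean ε@(mkℚ (ℤ.-[1+_] _) _ _) (*<* ()) k

-- Asymptotics of the product

a+k≤4k∧b+2k≤4k⇒8ab≤3[4k]² : ∀ k a b →
  a ℕ.+ k ℕ.≤ k ℕ.* 2 ℕ.* 2 → b ℕ.+ k ℕ.* 2 ℕ.≤ k ℕ.* 2 ℕ.* 2 →
  8 ℕ.* (a ℕ.* b) ℕ.≤ 3 ℕ.* (k ℕ.* 2 ℕ.* 2 ℕ.* (k ℕ.* 2 ℕ.* 2))
a+k≤4k∧b+2k≤4k⇒8ab≤3[4k]² k a b a+k≤ b+2k≤ = begin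
  8 ℕ.* (a ℕ.* b)                                 ≤⟨ ℕ.*-monoʳ-≤ 8 (ℕ.*-mono-≤ a≤3k b≤2k) ⟩
  8 ℕ.* (k ℕ.* 3 ℕ.* (k ℕ.* 2))                   ≡⟨ 8·3k·2k≡3[4k]² k ⟩
  3 ℕ.* (k ℕ.* 2 ℕ.* 2 ℕ.* (k ℕ.* 2 ℕ.* 2))       ∎
  where
  open ℕ.≤-Reasoning
  8·3k·2k≡3[4k]² : ∀ k → 8 ℕ.* (k ℕ.* 3 ℕ.* (k ℕ.* 2)) ≡ 3 ℕ.* (k ℕ.* 2 ℕ.* 2 ℕ.* (k ℕ.* 2 ℕ.* 2))
  8·3k·2k≡3[4k]² = solve-∀
  order≡3k+k : ∀ k → k ℕ.* 2 ℕ.* 2 ≡ k ℕ.* 3 ℕ.+ k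
  order≡3k+k = solve-∀
  order≡2k+2k : ∀ k → k ℕ.* 2 ℕ.* 2 ≡ k ℕ.* 2 ℕ.+ k ℕ.* 2
  order≡2k+2k = solve-∀
  a≤3k : a ℕ.≤ k ℕ.* 3
  a≤3k = ℕ.+-cancelʳ-≤ k a (k ℕ.* 3) (subst (a ℕ.+ k ℕ.≤_) (order≡3k+k k) a+k≤)
  b≤2k : b ℕ.≤ k ℕ.* 2
  b≤2k = ℕ.+-cancelʳ-≤ (k ℕ.* 2) b (k ℕ.* 2)
    (subst (b ℕ.+ k ℕ.* 2 ℕ.≤_) (order≡2k+2k k) b+2k≤)

8th*th*≤3n² : ∀ k → Fin k → (e : HasEdge (extremal k)) (e′ : HasEdge (complement (extremal k))) →
  8 ℕ.* (th* (extremal k) e ℕ.* th* (complement (extremal k)) e′)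
    ℕ.≤ 3 ℕ.* (order k ℕ.* order k)
8th*th*≤3n² k i e e′ = a+k≤4k∧b+2k≤4k⇒8ab≤3[4k]² k
  (th* (extremal k) e) (th* (complement (extremal k)) e′)
  (th*-extremal-≤ k e i) (th*-co-extremal-≤ k e′ (combine i zero))

lower-bound : (G : Graph n) (e : HasEdge G) (e′ : HasEdge (complement G)) →
  + 3 / 8 * fromℕ (n ℕ.^ 2) ≤ fromℕ (th* G e ℕ.* th* (complement G) e′) + fromℕ 4 * fromℕ n
lower-bound {n} G e e′ = 3a≤8b+32n⇒3/8a≤b+4n {n ℕ.^ 2} {th* G e ℕ.* th* (complement G) e′} n
  (subst (λ x → 3 ℕ.* x ℕ.≤ 8 ℕ.* (th* G e ℕ.* th* (complement G) e′) ℕ.+ 32 ℕ.* n)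
    (sym (n^2≡n*n n)) (3n²≤8th*th*+32n G e e′))

-- Multiply 4 ≤ δM ≤ δn by n; this turns the linear error into o(n²).
4n≤δn² : ∀ δ M n → fromℕ 4 ≤ δ * fromℕ M → 0ℚ < δ → M ℕ.≤ n →
  fromℕ 4 * fromℕ n ≤ δ * fromℕ (n ℕ.^ 2)
4n≤δn² δ M n 4≤δM 0<δ M≤n = begin
  fromℕ 4 * fromℕ n          ≤⟨ ℚ.*-monoʳ-≤-nonNeg (fromℕ n) {{nonNegative (fromℕ-mono-≤ {0} {n} z≤n)}} 4≤δM ⟩
  δ * fromℕ M * fromℕ n      ≡⟨ trans (ℚ.*-assoc δ (fromℕ M) (fromℕ n)) (cong (δ *_) (sym (fromℕ-* M n))) ⟩
  δ * fromℕ (M ℕ.* n)        ≤⟨ ℚ.*-monoˡ-≤-nonNeg δ {{nonNegative (ℚ.<⇒≤ 0<δ)}}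
                                  (fromℕ-mono-≤ {M ℕ.* n} {n ℕ.* n} (ℕ.*-monoˡ-≤ n M≤n)) ⟩
  δ * fromℕ (n ℕ.* n)        ≡⟨ cong (λ x → δ * fromℕ x) (n^2≡n*n n) ⟨
  δ * fromℕ (n ℕ.^ 2)        ∎
  where open ℚ.≤-Reasoning

-- The assumed upper bound is exactly 3n²/8 and the general lower bound falls short of it by 4n, so
-- the distance is at most 4n. This is at most δn² as soon as δn ≥ 4.
quadratic-upper-bound⇒tight : (N : ℕ → ℕ) (G : ∀ m → Graph (N m))
  (e : ∀ m → HasEdge (G m)) (e′ : ∀ m → HasEdge (complement (G m))) →
  (∀ m → m ℕ.≤ N m) →
  (∀ m → 8 ℕ.* (th* (G m) (e m) ℕ.* th* (complement (G m)) (e′ m)) ℕ.≤ 3 ℕ.* (N m ℕ.* N m)) →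
  ∀ (δ : ℚ) → 0ℚ < δ → Σ[ M ∈ ℕ ] (∀ m → M ℕ.≤ m →
    ∣ fromℕ (th* (G m) (e m) ℕ.* th* (complement (G m)) (e′ m))
        - (+ 3 / 8) * fromℕ (N m ℕ.^ 2) ∣
      ≤ δ * fromℕ (N m ℕ.^ 2))
quadratic-upper-bound⇒tight N G e e′ m≤N upper δ 0<δ = M , close
  where
  M : ℕ
  M = proj₁ (archimedean δ 0<δ 4)

  close : ∀ m → M ℕ.≤ m →
    ∣ fromℕ (th* (G m) (e m) ℕ.* th* (complement (G m)) (e′ m))
    - (+ 3 / 8) * fromℕ (N m ℕ.^ 2) ∣ ≤ δ * fromℕ (N m ℕ.^ 2)
  close m M≤m = ℚ.≤-trans
    (∣p-q∣≤r K 3/8N² 4N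
      (p-q≤r K 3/8N² 4N (subst (_≤ 4N + 3/8N²) (ℚ.+-identityˡ K) (ℚ.+-mono-≤ 0≤4N K≤3/8N²)))
      (p-q≤r 3/8N² K 4N (ℚ.≤-trans (lower-bound (G m) (e m) (e′ m))
        (ℚ.≤-reflexive (ℚ.+-comm K 4N)))))
    (4n≤δn² δ M (N m) (proj₂ (archimedean δ 0<δ 4)) 0<δ (ℕ.≤-trans M≤m (m≤N m)))
    where
    K 3/8N² 4N : ℚ
    K     = fromℕ (th* (G m) (e m) ℕ.* th* (complement (G m)) (e′ m))
    3/8N² = + 3 / 8 * fromℕ (N m ℕ.^ 2)
    4N    = fromℕ 4 * fromℕ (N m)
    0≤4N : 0ℚ ≤ 4N
    0≤4N = subst (0ℚ ≤_) (fromℕ-* 4 (N m)) (fromℕ-mono-≤ {0} {4 ℕ.* N m} z≤n)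
    K≤3/8N² : K ≤ 3/8N²
    K≤3/8N² = 8b≤3a⇒b≤3/8a {N m ℕ.^ 2} {th* (G m) (e m) ℕ.* th* (complement (G m)) (e′ m)}
      (subst (λ x → 8 ℕ.* (th* (G m) (e m) ℕ.* th* (complement (G m)) (e′ m)) ℕ.≤ 3 ℕ.* x)
        (sym (n^2≡n*n (N m))) (upper m))

theorem2p12 : (Σ[ C ∈ ℚ ] 0ℚ < C ×
    (∀ (n : ℕ) (G : Graph n) → 4 ℕ.≤ n →
    (e : HasEdge G) (e′ : HasEdge (complement G)) →
    (+ 3 / 8) * fromℕ (n ℕ.^ 2) - C * fromℕ n
    ≤ fromℕ (th* G e ℕ.* th* (complement G) e′)))
    ×
    (Σ[ n ∈ (ℕ → ℕ) ] Σ[ G ∈ (∀ m → Graph (n m)) ]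
    Σ[ e ∈ (∀ m → HasEdge (G m)) ] Σ[ e′ ∈ (∀ m → HasEdge (complement (G m))) ]
    (∀ m → n m ℕ.< n (suc m)) ×
    (∀ m → Connected (G m)) ×
    (∀ m → Connected (complement (G m))) ×
    (∀ (ε : ℚ) → 0ℚ < ε → Σ[ M ∈ ℕ ] (∀ m → M ℕ.≤ m →
    ∣ fromℕ (th* (G m) (e m) ℕ.* th* (complement (G m)) (e′ m))
    - (+ 3 / 8) * fromℕ (n m ℕ.^ 2) ∣
    ≤ ε * fromℕ (n m ℕ.^ 2))))
theorem2p12 =
    -- The constant is 32/8, from the error 32n in the integer inequality.
    ( fromℕ 4 , *<* (ℤ.+<+ (s≤s z≤n))
    , λ n G _ e e′ → p-q≤r (+ 3 / 8 * fromℕ (n ℕ.^ 2)) (fromℕ 4 * fromℕ n) _ (lower-bound G e e′))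
  -- Starting at k = 2 leaves at least four indices p, enough for `third-element`.
  , (λ m → order (2 ℕ.+ m)) , (λ m → extremal (2 ℕ.+ m)) , e , e′ , order-increasing , connected
  , (λ m → co-extremal-connected (2 ℕ.+ m))
  , quadratic-upper-bound⇒tight (λ m → order (2 ℕ.+ m)) (λ m → extremal (2 ℕ.+ m)) e e′ m≤order upper
  where
  e : ∀ m → HasEdge (extremal (2 ℕ.+ m))
  e m = vertex (2 ℕ.+ m) zero zero , vertex (2 ℕ.+ m) (suc zero) (suc zero)
      , adj-vertex⁺ (2 ℕ.+ m) {zero} {suc zero} {zero} {suc zero} λ ()

  e′ : ∀ m → HasEdge (complement (extremal (2 ℕ.+ m)))
  e′ m = vertex (2 ℕ.+ m) zero zero , vertex (2 ℕ.+ m) zero (suc zero)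
       , coadj-vertex (2 ℕ.+ m) {zero} {zero} {zero} {suc zero} (λ ()) λ p≢p → p≢p refl

  order-increasing : ∀ m → order (2 ℕ.+ m) ℕ.< order (2 ℕ.+ suc m)
  order-increasing m = ℕ.*-monoˡ-< 2 (ℕ.*-monoˡ-< 2 (ℕ.n<1+n (2 ℕ.+ m)))

  connected : ∀ m → Connected (extremal (2 ℕ.+ m))
  connected m = extremal-connected (2 ℕ.+ m) third-element

  m≤order : ∀ m → m ℕ.≤ order (2 ℕ.+ m)
  m≤order m = ℕ.≤-trans (ℕ.m≤n+m m 2)
    (ℕ.≤-trans (ℕ.m≤m*n (2 ℕ.+ m) 2) (ℕ.m≤m*n ((2 ℕ.+ m) ℕ.* 2) 2))

  upper : ∀ m → 8 ℕ.* (th* (extremal (2 ℕ.+ m)) (e m) ℕ.* th* (complement (extremal (2 ℕ.+ m))) (e′ m))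
    ℕ.≤ 3 ℕ.* (order (2 ℕ.+ m) ℕ.* order (2 ℕ.+ m))
  upper m = 8th*th*≤3n² (2 ℕ.+ m) zero (e m) (e′ m)
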